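{- Let $\pi:E\to[n]$ be a surjection from a finite set $E$ with $|\pi^{ -1}(i)|\ge2$ for every $i$. For every nonempty $\pi$-colored set $S$, the minimum support function of $\mathsf T_S-e_S$ restricts on the rays of $\Sigma_\pi$ to $$h(\mathsf T_S-e_S,e_R)=\mathrm f_S^\pi(e_R)-\sum_{s\in S}\ell_s(e_R)\qquad\text{for all nonempty }\pi\text{ -colored }R.$$ Consequently, in the outward convention, the translated factor simplices and the translated truncations restrict to the nef basis $$\alpha_i\ (i\in[n]),\qquad \sum_{i\in I(S)}\alpha_i-[\mathrm f_S^\pi]\ \ (S\ \pi\text{ -colored},\ |S|\ge2)$$ of the space of piecewise linear functions on $\Sigma_\pi$ modulo global linear functions. Moreover, if $\widehat{\mathsf T}_S=\operatorname{DTr}[\Delta(\mathbf E),\Delta(\overline{\mathbf E}(S))]$, then $$\left(h(\widehat{\mathsf T}_S,\cdot)-h(\Delta(\mathbf E),\cdot)\right)\big|_{\Sigma_\pi}=\mathrm f_S^\pi.$$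
   Context: Put $E_i=\pi^{ -1}(i)$, $\mathbf E=(E_1,\dots,E_n)$, $e_T=\sum_{s\in T}e_s\in\mathbb R^E$ for $T\subseteq E$, and $\mathsf L(\mathbf E)=\operatorname{Span}\{e_{E_1},\dots,e_{E_n}\}$. A set $S\subseteq E$ is $\pi$-colored if $|S\cap E_i|\le1$ for every $i$. The $\pi$-colored fan $\Sigma_\pi$ in $\mathbb R^E/\mathsf L(\mathbf E)$ consists of the images of the cones $\operatorname{Cone}(e_{S_1},\dots,e_{S_k})$ for chains $S_1\subsetneq\dots\subsetneq S_k$ of nonempty $\pi$-colored sets. It is simplicial, so a piecewise linear function on $\Sigma_\pi$ (linear on each cone) is determined by arbitrary values on the ray generators $e_R$, $R$ nonempty $\pi$-colored. Global linear functions are restrictions of linear functionals on $\mathbb R^E/\mathsf L(\mathbf E)$; $[\cdot]$ denotes the class modulo these. Define piecewise linear functions by $\mathrm f_S^\pi(e_R)=1$ if $S\subseteq R$ and $0$ otherwise, and $\ell_s(e_R)=1$ if $s\in R$ and $0$ otherwise ($s\in E$). For $s,t\in E_i$ the difference $\ell_s-\ell_t$ is global linear; $\alpha_i$ denotes the common class of $\ell_s$, $s\in E_i$. Support functions are $h(\mathsf Q,u)=\min_{x\in\mathsf Q}u\cdot x$. The outward convention uses $h_{\max}(-\mathsf Q,u)=-h(\mathsf Q,u)$, where $h_{\max}(\mathsf Q,u)=\max_{x\in\mathsf Q}u\cdot x$. Thus the translated factor simplices contribute the classes of the restrictions of $h_{\max}(e_s-\Delta(E_i),\cdot)$ with $s\in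 E_i$ (equal to $\alpha_i$), and the translated truncations contribute the classes of the restrictions of $h_{\max}(e_S-\mathsf T_S,\cdot)$. A class is nef when, as here, it is represented by the restriction to $\Sigma_\pi$ of such an outward support function of a polytope $-\mathsf Q$ whose outer normal fan (equivalently the inner normal fan of $\mathsf Q$) coarsens the barycentric subdivision of the inner normal fan of $\Delta(\mathbf E)$. For a tuple $\mathbf T=(T_j)$ of disjoint nonempty subsets of $E$, $\Delta(\mathbf T)=\prod_j\operatorname{conv}\{e_s:s\in T_j\}\subset\mathbb R^E$ (zero in other coordinates). For $\mathbf A=(A_j)$ with $\emptyset\ne A_j\subseteq T_j$, not all equal, the deep truncation along the face $\Delta(\mathbf A)$ is $\operatorname{DTr}[\Delta(\mathbf T),\Delta(\mathbf A)]=\{x\in\Delta(\mathbf T) : \sum_j\sum_{s\in T_j\setminus A_j}x(s)\ge1\}$. For a nonempty $\pi$-colored $S$: $I(S)=\{i : S\cap E_i\ne\emptyset\}$, $\overline E_i(S)=E_i\setminus(S\cap E_i)$, $\mathbf E_S=(E_i)_{i\in I(S)}$, $\overline{\mathbf E}_S=(\overline E_i(S))_{i\in I(S)}$, $\overline{\mathbf E}(S)=(\overline E_1(S),\dots,\overline E_n(S))$, and $\mathsf T_S=\operatorname{DTr}[\Delta(\mathbf E_S),\Delta(\overline{\mathbf E}_S)]$. -}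

module Defs where

open import Level using (Level; _⊔_; suc)
open import Algebra.Bundles using (CommutativeRing)
import Algebra.Properties.CommutativeMonoid.Sum as Sum
open import Data.Bool.Base using (if_then_else_)
open import Data.Fin.Base as Fin using (Fin)
import Data.Fin.Properties as Fin
open import Data.Fin.Subset
  using (Subset; inside; outside; ⊤; ⁅_⁆; _∈_; _∉_; _⊆_; _⊂_; _∩_; _─_; Nonempty; ∣_∣)
open import Data.Fin.Subset.Properties using (_∈?_; _⊆?_; nonempty?)
open import Data.Nat.Base as ℕ using (ℕ)
open import Data.Product using (∃; ∃₂; _×_; _,_; proj₁; proj₂)
open import Data.Vec.Base using ([]; _∷_; tabulate)
open import Function.Bundles using (_⇔_)
open import Function.Definitions using (Surjective)
open import Relation.Binary.Core using (Rel)
open import Relation.Binary.PropositionalEquality using (_≡_)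
open import Relation.Binary.Structures using (IsDecTotalOrder)
open import Relation.Nullary using (¬_; does)
open import Relation.Unary using (Pred)

-- The library has no real numbers.  Everything below is over an arbitrary
-- ordered field with decidable order, classically including ℝ.
record OrderedField c ℓ₁ ℓ₂ : Set (suc (c ⊔ ℓ₁ ⊔ ℓ₂)) where
  infix 4 _≤_
  field
    commutativeRing : CommutativeRing c ℓ₁
  open CommutativeRing commutativeRing public
  field
    _≤_             : Rel Carrier ℓ₂
    isDecTotalOrder : IsDecTotalOrder _≈_ _≤_
    +-monoʳ-≤       : ∀ x {y z} → y ≤ z → x + y ≤ x + z
    *-nonNeg        : ∀ {x y} → 0# ≤ x → 0# ≤ y → 0# ≤ x * y
    0≤1             : 0# ≤ 1#
    1≉0             : ¬ 1# ≈ 0#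
    inverse         : ∀ x → ¬ x ≈ 0# → ∃ λ y → x * y ≈ 1#

record Chain {p} {m} (P : Pred (Subset m) p) : Set p where
  field
    length     : ℕ
    set        : Fin length → Subset m
    member     : ∀ j → P (set j)
    increasing : ∀ {i j} → i Fin.< j → set i ⊂ set j

-- The finite set E is Fin m.
module ColoredFan
  {c ℓ₁ ℓ₂} (K : OrderedField c ℓ₁ ℓ₂)
  {m n} (π : Fin m → Fin n) (π-surjective : Surjective _≡_ _≡_ π)
  where

  open OrderedField K
  open Sum +-commutativeMonoid using (sum)

  private
    a : Level
    a = c ⊔ ℓ₁ ⊔ ℓ₂

  V : Set c
  V = Fin m → Carrier

  infix 8 _·_
  _·_ : V → V → Carrier
  u · x = sum λ s → u s * x s

  ∑∈ : ∀ {k} → Subset k → (Fin k → Carrier) → Carrier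
  ∑∈ T g = sum λ s → if does (s ∈? T) then g s else 0#

  ∑⊆ : ∀ {k} → (Subset k → Carrier) → Carrier
  ∑⊆ {ℕ.zero}  g = g []
  ∑⊆ {ℕ.suc k} g = ∑⊆ (λ S → g (outside ∷ S)) + ∑⊆ (λ S → g (inside ∷ S))

  e : Subset m → V
  e T s = if does (s ∈? T) then 1# else 0#

  E : Fin n → Subset m
  E i = tabulate λ s → does (π s Fin.≟ i)

  IsColored : Pred (Subset m) _
  IsColored S = ∀ i → ∣ S ∩ E i ∣ ℕ.≤ 1

  -- Congruence modulo L(E) = Span {e_{E_1}, …, e_{E_n}}; the quotient ℝ^E / L(E)
  -- is handled through representatives in ℝ^E.
  infix 4 _≡L_
  _≡L_ : Rel V (c ⊔ ℓ₁)
  u ≡L v = ∃ λ (b : Fin n → Carrier) → ∀ s → u s - v s ≈ sum λ i → b i * e (E i) s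

  combination : ∀ {p} {P : Pred (Subset m) p} (C : Chain P) →
                (Fin (Chain.length C) → Carrier) → V
  combination C coef s = sum λ j → coef j * e (Chain.set C j) s

  ------------------------------------------------------------------------
  -- Polytopes and their normal fans

  Region : Set (suc a)
  Region = Pred V a

  IsMin IsMax : Region → V → Carrier → Set a
  IsMin Q u μ = (∃ λ x → Q x × u · x ≈ μ) × (∀ x → Q x → μ ≤ u · x)
  IsMax Q u μ = (∃ λ x → Q x × u · x ≈ μ) × (∀ x → Q x → u · x ≤ μ)

  translate : Region → V → Region
  translate Q v x = Q λ s → x s + v s      -- Q - v

  reflect : V → Region → Region
  reflect v Q x = Q λ s → v s - x s        -- v - Q

  negate : Region → Region
  negate Q x = Q λ s → - x s               -- - Q

  -- A bounded intersection of finitely many closed half-spaces.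
  IsPolytope : Region → Set a
  IsPolytope Q =
    (∃ λ k → ∃₂ λ (A : Fin k → V) (b : Fin k → Carrier) →
       ∀ x → Q x ⇔ (∀ i → b i ≤ A i · x)) ×
    (∃ λ B → ∀ x → Q x → ∀ s → - B ≤ x s × x s ≤ B)

  Face : Region → V → Region
  Face Q u x = Q x × (∀ y → Q y → u · x ≤ u · y)

  -- The inner normal fan of Q consists of the cones NormalCone Q v for those v
  -- for which Face Q v is nonempty.
  NormalCone : Region → V → Region
  NormalCone Q v u = ∀ x → Face Q v x → Face Q u x

  -- Convex hull of the e_s with s ∈ T.
  Simplex : Subset m → Region
  Simplex T x = ∃ λ (w : Fin m → Carrier) →
    (∀ s → 0# ≤ w s) × (∀ s → s ∉ T → w s ≈ 0#) × sum w ≈ 1# ×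
    (∀ t → x t ≈ sum λ s → w s * e ⁅ s ⁆ t)

  -- Product of the simplices on the sets T j with j ∈ J.  As these sets are
  -- disjoint, the point with components y j is the sum of the y j in ℝ^E.
  Δ : Subset n → (Fin n → Subset m) → Region
  Δ J T x = ∃ λ (y : Fin n → V) →
    (∀ j → j ∈ J → Simplex (T j) (y j)) × (∀ s → x s ≈ ∑∈ J λ j → y j s)

  DTr : Subset n → (Fin n → Subset m) → (Fin n → Subset m) → Region
  DTr J T A x = Δ J T x × 1# ≤ ∑∈ J λ j → ∑∈ (T j ─ A j) x

  I : Subset m → Subset n
  I S = tabulate λ i → does (nonempty? (S ∩ E i))

  Ē : Subset m → Fin n → Subset m
  Ē S i = E i ─ (S ∩ E i)

  ΔE : Region
  ΔE = Δ ⊤ E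

  T : Subset m → Region
  T S = DTr (I S) E (Ē S)

  T̂ : Subset m → Region
  T̂ S = DTr ⊤ E (Ē S)

  ------------------------------------------------------------------------
  -- The barycentric subdivision of the inner normal fan of Δ(E)

  -- The ray generators of that fan modulo L(E) are the e_s, so a cone σ has
  -- barycentre e_R where R = { s | e_s ∈ σ }.  The fan is simplicial, so σ is
  -- determined by R, is nonzero iff R is nonempty, and inclusion of cones is
  -- inclusion of the sets R.
  IsNormalConeRays : Pred (Subset m) a
  IsNormalConeRays R = ∃ λ v →
    ∃ (Face ΔE v) × (∀ s → s ∈ R ⇔ NormalCone ΔE v (e ⁅ s ⁆))

  BarycentricCone : Set a
  BarycentricCone = Chain λ R → Nonempty R × IsNormalConeRays R

  _∈ᵇ_ : V → BarycentricCone → Set a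
  u ∈ᵇ C = ∃ λ coef → (∀ j → 0# ≤ coef j) × u ≡L combination C coef

  -- Both fans are complete, so one coarsens the other as soon as every cone of
  -- the finer one lies in a cone of the coarser one.
  NormalFanCoarsensBarycentric : Region → Set a
  NormalFanCoarsensBarycentric Q = (C : BarycentricCone) → ∃ λ v →
    ∃ (Face Q v) × (∀ u → u ∈ᵇ C → NormalCone Q v u)

  ------------------------------------------------------------------------
  -- Piecewise linear functions on Σ_π

  ColoredChain : Set
  ColoredChain = Chain λ S → Nonempty S × IsColored S

  record FanPoint : Set a where
    field
      chain  : ColoredChain
      coef   : Fin (Chain.length chain) → Carrier
      coef≥0 : ∀ j → 0# ≤ coef j
    point : V
    point = combination chain coef

  open FanPoint public

  FanFunction : Set a
  FanFunction = FanPoint → Carrier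

  ray : ∀ R → Nonempty R → IsColored R → FanPoint
  ray R ne col = record
    { chain  = record { length = 1 ; set = λ _ → R ; member = λ _ → ne , col
                      ; increasing = λ { {Fin.zero} {Fin.zero} () } }
    ; coef   = λ _ → 1#
    ; coef≥0 = λ _ → 0≤1
    }

  -- A point of the support may lie in several cones and have several
  -- representatives modulo L(E); the first component says that g does not
  -- depend on these choices, the second that g is linear on each cone.
  IsPiecewiseLinear : Pred FanFunction a
  IsPiecewiseLinear g =
    (∀ p q → point p ≡L point q → g p ≈ g q) ×
    (∀ p → let open Chain (chain p) in
       g p ≈ sum λ j → coef p j * g (ray (set j) (proj₁ (member j)) (proj₂ (member j))))

  -- The piecewise linear function with value φ R at e_R.
  fromRays : (Subset m → Carrier) → FanFunction
  fromRays φ p = sum λ j → coef p j * φ (Chain.set (chain p) j)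

  f : Subset m → FanFunction
  f S = fromRays λ R → if does (S ⊆? R) then 1# else 0#

  ℓ : Fin m → FanFunction
  ℓ s = fromRays λ R → if does (s ∈? R) then 1# else 0#

  -- Equality modulo (restrictions of) linear functionals on ℝ^E / L(E).
  infix 4 _∼_
  _∼_ : Rel FanFunction a
  g ∼ h = ∃ λ (b : V) → (∀ i → b · e (E i) ≈ 0#) × (∀ p → g p - h p ≈ b · point p)

  -- α i is represented by ℓ s for one s in the fibre over i.
  α : Fin n → FanFunction
  α i = ℓ (proj₁ (π-surjective i))

  β : Subset m → FanFunction
  β S p = ∑∈ (I S) (λ i → α i p) - f S p

  -- h_max(Q,·) is constant on cosets of L(E) over the support of Σ_π and its
  -- restriction to Σ_π is g.
  MaxRestrictsTo : Region → FanFunction → Set a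
  MaxRestrictsTo Q g = ∀ p u → u ≡L point p → IsMax Q u (g p)

  MaxRestrictsToClass : Region → FanFunction → Set a
  MaxRestrictsToClass Q h = ∃ λ g → MaxRestrictsTo Q g × g ∼ h

  IsNef : FanFunction → Set (suc a)
  IsNef g = ∃ λ Q →
    IsPolytope Q × NormalFanCoarsensBarycentric Q × MaxRestrictsToClass (negate Q) g

  -- The classes of x i (i ∈ [n]) and y S (P S) form a basis of the space of
  -- piecewise linear functions modulo ∼.
  record IsBasis {p} (x : Fin n → FanFunction)
                 (P : Pred (Subset m) p) (y : Subset m → FanFunction) : Set (a ⊔ p) where
    combine : (Fin n → Carrier) → (Subset m → Carrier) → FanFunction
    combine b d q = (sum λ i → b i * x i q) + ∑⊆ λ S → d S * y S q

    SupportedOnP : (Subset m → Carrier) → Set (ℓ₁ ⊔ p)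
    SupportedOnP d = ∀ S → ¬ P S → d S ≈ 0#

    field
      x-pl        : ∀ i → IsPiecewiseLinear (x i)
      y-pl        : ∀ S → P S → IsPiecewiseLinear (y S)
      spanning    : ∀ g → IsPiecewiseLinear g →
                    ∃₂ λ b d → SupportedOnP d × g ∼ combine b d
      independent : ∀ b d → SupportedOnP d → combine b d ∼ (λ _ → 0#) →
                    (∀ i → b i ≈ 0#) × (∀ S → d S ≈ 0#)

{-# OPTIONS --safe #-}
module Submission where

-- Every support function here is computed from one explicit minimiser.  Let
-- R_1 ⊂ ... ⊂ R_k be a chain of proper sets, that is, of sets containing no
-- whole colour class E_i; colored sets are proper because |E_i| ≥ 2.  On the
-- truncation DTr[Δ(E_j : j ∈ J), Ē(S)] with I(S) ⊆ J all coordinates are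
-- nonnegative and those indexed by S have sum at least 1, so e_R is at least 1
-- if S ⊆ R, and at least 0 in any case.  Along the chain these bounds are
-- attained at a single vertex: give weight 1 to an element r of S lying only in
-- those R_j that contain S (pivot), and, in each other colour of J, to an
-- element outside all R_j (avoiding).  Since e_{E_i} is constant on the region,
-- the minimum of any u ≡ Σ_j c_j e_{R_j} modulo L(E) with c_j ≥ 0 is
-- Σ_j c_j [S ⊆ R_j] plus a term that depends only on the difference in L(E).
-- These properties are recorded in Adapted, which also holds, with lower bound
-- 0, for the simplices and products of simplices, and is stable under
-- translation.  It yields the formula on rays, the two classes of outward
-- support functions and the identity for the truncations of Δ(E).
--
-- The same simultaneous minimiser gives nefness.  A face that minimises
-- Σ_j e_{R_j} minimises every e_{R_j}, hence every u in the cone spanned by the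
-- e_{R_j} and L(E) (adapted-coarsens).  The cones of the barycentric subdivision
-- are of this form: the rays e_s of a normal cone of Δ(E) form a proper set, for
-- otherwise all coordinates of some colour would vanish on the face
-- (normal-cone-proper).  A product of simplices is cut out by x ≥ 0 and the
-- values of the e_{E_i}, and its truncation by one further inequality, so all
-- regions are polytopes.
--
-- For the basis, β_S = Σ_{i ∈ I(S)} α_i - f_S, and β_S is globally linear when
-- |S| = 1.  A piecewise linear function is determined by its values on the rays,
-- and Möbius inversion over subsets writes it as a combination of the f_S with S
-- nonempty colored; substituting f_S = Σ α_i - β_S shows that the α_i and β_S
-- span.  In a relation between them modulo linear functions, the value at e_R is
-- e_R · w - Σ_{S ⊆ R} d_S for a weight w on E, where d_S is the coefficient of
-- β_S.  At singletons R the sum is zero because only |S| ≥ 2 occurs, so w = 0;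
-- hence the sum is zero for all colored R, and the d_S vanish by Möbius inversion.
-- Then w is b_i at the representative of each colour i, and 0 elsewhere, minus a
-- vector whose coordinates sum to zero over E_i, so b_i = 0.

open import Defs
open import Algebra.Bundles using (CommutativeRing)
import Algebra.Properties.AbelianGroup as AbelianGroupProperties
import Algebra.Properties.Ring as RingProperties
import Algebra.Properties.Semiring.Mult as Mult
import Algebra.Properties.Semiring.Sum as SemiringSum
import Algebra.Solver.Ring as RingSolver
open import Algebra.Solver.Ring.AlmostCommutativeRing using (_-Raw-AlmostCommutative⟶_; fromCommutativeRing)
open import Data.Bool.Base using (if_then_else_)
open import Data.Fin.Base as Fin using (Fin)
import Data.Fin.Properties as Fin
open import Data.Fin.Subset
  using (Subset; inside; outside; ⊤; ⁅_⁆; _∈_; _∉_; _⊆_; _⊂_; _∩_; _─_; Nonempty; Empty; ∣_∣)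
open import Data.Fin.Subset.Properties
open import Data.Integer.Base as ℤ using (ℤ; +_; -[1+_]; _⊖_)
import Data.Integer.Properties as ℤ
import Data.Maybe.Base as Maybe
open import Data.Nat.Base as ℕ using (ℕ)
import Data.Nat.Properties as ℕ
open import Data.Product using (∃; ∃₂; _×_; _,_; proj₁; proj₂)
open import Data.Sum.Base using ([_,_]′; inj₁; inj₂)
open import Data.Vec.Base using ([]; _∷_; tabulate; there)
open import Data.Vec.Properties using (lookup⇒[]=; []=⇒lookup; lookup∘tabulate)
open import Function.Base using (_∘_)
open import Function.Bundles using (_⇔_; mk⇔; Equivalence)
open import Function.Construct.Symmetry using (⇔-sym)
open import Function.Definitions using (Surjective)
open import Level using (_⊔_)
open import Relation.Binary.PropositionalEquality as ≡ using (_≡_; _≢_)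
import Relation.Binary.Reasoning.PartialOrder as PosetReasoning
open import Relation.Binary.Bundles using (Poset)
open import Relation.Binary.Structures using (IsDecTotalOrder)
open import Relation.Nullary using (¬_; Dec; does; yes; no; contradiction)
open import Relation.Nullary.Decidable using (dec-true; dec⇒maybe; _×-dec_; ¬?)
open import Relation.Unary using (Pred)

open Equivalence using (to; from)

-- Identities in commutative rings

-- A solver for identities in an arbitrary commutative ring, with integer
-- coefficients, so that cancellations are recognised.
module IntegerCoefficients {c ℓ} (R : CommutativeRing c ℓ) where

  open CommutativeRing R
  open Mult semiring using (×-homo-+; ×1-homo-*) renaming (_×_ to _times_)
  open RingProperties ring using (-‿distribˡ-*; -‿distribʳ-*)
  open AbelianGroupProperties +-abelianGroup
    using (ε⁻¹≈ε; ⁻¹-∙-comm; ⁻¹-involutive)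
  open import Relation.Binary.Reasoning.Setoid setoid

  infix 9 _·1
  _·1 : ℕ → Carrier
  n ·1 = n times 1#

  -- The canonical map from the integers.
  ⟦_⟧ℤ : ℤ → Carrier
  ⟦ + n ⟧ℤ      = n ·1
  ⟦ -[1+ n ] ⟧ℤ = - (ℕ.suc n ·1)

  -- Cancellation of a common summand in a difference.
  cancel : ∀ x y z → y + - z ≈ x + y + - (x + z)
  cancel x y z = sym (begin
    x + y + - (x + z)    ≈⟨ +-cong (+-comm x y) (sym (⁻¹-∙-comm x z)) ⟩
    y + x + (- x + - z)  ≈⟨ +-assoc y x _ ⟩
    y + (x + (- x + - z)) ≈⟨ +-congˡ (sym (+-assoc x _ _)) ⟩
    y + (x + - x + - z)  ≈⟨ +-congˡ (+-congʳ (-‿inverseʳ x)) ⟩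
    y + (0# + - z)       ≈⟨ +-congˡ (+-identityˡ _) ⟩
    y + - z              ∎)

  ⟦⊖⟧ : ∀ m n → ⟦ m ⊖ n ⟧ℤ ≈ m ·1 + - (n ·1)
  ⟦⊖⟧ ℕ.zero    ℕ.zero    = sym (-‿inverseʳ 0#)
  ⟦⊖⟧ ℕ.zero    (ℕ.suc n) = sym (+-identityˡ _)
  ⟦⊖⟧ (ℕ.suc m) ℕ.zero    = sym (trans (+-congˡ ε⁻¹≈ε) (+-identityʳ _))
  ⟦⊖⟧ (ℕ.suc m) (ℕ.suc n) = begin
    ⟦ ℕ.suc m ⊖ ℕ.suc n ⟧ℤ  ≡⟨ ≡.cong ⟦_⟧ℤ (ℤ.[1+m]⊖[1+n]≡m⊖n m n) ⟩
    ⟦ m ⊖ n ⟧ℤ              ≈⟨ ⟦⊖⟧ m n ⟩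
    m ·1 + - (n ·1)     ≈⟨ cancel 1# _ _ ⟩
    1# + m ·1 + - (1# + n ·1) ∎

  ⟦-⟧ : ∀ i → ⟦ ℤ.- i ⟧ℤ ≈ - ⟦ i ⟧ℤ
  ⟦-⟧ (+ ℕ.zero)  = sym ε⁻¹≈ε
  ⟦-⟧ (+ ℕ.suc n) = refl
  ⟦-⟧ -[1+ n ]    = sym (⁻¹-involutive _)

  ⟦+⟧ : ∀ i j → ⟦ i ℤ.+ j ⟧ℤ ≈ ⟦ i ⟧ℤ + ⟦ j ⟧ℤ
  ⟦+⟧ (+ m)    (+ n)    = ×-homo-+ 1# m n
  ⟦+⟧ (+ m)    -[1+ n ] = ⟦⊖⟧ m (ℕ.suc n)
  ⟦+⟧ -[1+ m ] (+ n)    = trans (⟦⊖⟧ n (ℕ.suc m)) (+-comm _ _)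
  ⟦+⟧ -[1+ m ] -[1+ n ] = begin
    - (1# + (1# + (m ℕ.+ n) ·1))   ≈⟨ -‿cong (+-congˡ (+-congˡ (×-homo-+ 1# m n))) ⟩
    - (1# + (1# + (m ·1 + n ·1))) ≈⟨ -‿cong (+-congˡ swap) ⟩
    - (1# + (m ·1 + (1# + n ·1))) ≈⟨ -‿cong (sym (+-assoc _ _ _)) ⟩
    - (1# + m ·1 + (1# + n ·1))  ≈⟨ sym (⁻¹-∙-comm _ _) ⟩
    - (1# + m ·1) + - (1# + n ·1) ∎
    where
    swap : ∀ {x y z} → x + (y + z) ≈ y + (x + z)
    swap = trans (sym (+-assoc _ _ _)) (trans (+-congʳ (+-comm _ _)) (+-assoc _ _ _))

  ⟦+*⟧ : ∀ m j → ⟦ + m ℤ.* j ⟧ℤ ≈ m ·1 * ⟦ j ⟧ℤ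
  ⟦+*⟧ m (+ n) = trans (reflexive (≡.cong ⟦_⟧ℤ (≡.sym (ℤ.pos-* m n)))) (×1-homo-* m n)
  ⟦+*⟧ m -[1+ n ] = begin
    ⟦ + m ℤ.* -[1+ n ] ⟧ℤ           ≡⟨ ≡.cong ⟦_⟧ℤ (ℤ.neg-distribʳ-* (+ m) (+ ℕ.suc n)) ⟨
    ⟦ ℤ.- (+ m ℤ.* + ℕ.suc n) ⟧ℤ    ≈⟨ ⟦-⟧ (+ m ℤ.* + ℕ.suc n) ⟩
    - ⟦ + m ℤ.* + ℕ.suc n ⟧ℤ        ≈⟨ -‿cong (⟦+*⟧ m (+ ℕ.suc n)) ⟩
    - (m ·1 * ℕ.suc n ·1)       ≈⟨ -‿distribʳ-* _ _ ⟩
    m ·1 * - (ℕ.suc n ·1)       ∎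

  ⟦*⟧ : ∀ i j → ⟦ i ℤ.* j ⟧ℤ ≈ ⟦ i ⟧ℤ * ⟦ j ⟧ℤ
  ⟦*⟧ (+ m)    j = ⟦+*⟧ m j
  ⟦*⟧ -[1+ m ] j = begin
    ⟦ -[1+ m ] ℤ.* j ⟧ℤ         ≡⟨ ≡.cong ⟦_⟧ℤ (ℤ.neg-distribˡ-* (+ ℕ.suc m) j) ⟨
    ⟦ ℤ.- (+ ℕ.suc m ℤ.* j) ⟧ℤ  ≈⟨ ⟦-⟧ (+ ℕ.suc m ℤ.* j) ⟩
    - ⟦ + ℕ.suc m ℤ.* j ⟧ℤ      ≈⟨ -‿cong (⟦+*⟧ (ℕ.suc m) j) ⟩
    - (ℕ.suc m ·1 * ⟦ j ⟧ℤ)   ≈⟨ -‿distribˡ-* _ _ ⟩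
    - (ℕ.suc m ·1) * ⟦ j ⟧ℤ   ∎

  ℤ→R : ℤ.+-*-rawRing -Raw-AlmostCommutative⟶ fromCommutativeRing R
  ℤ→R = record
    { ⟦_⟧    = ⟦_⟧ℤ
    ; +-homo = ⟦+⟧
    ; *-homo = ⟦*⟧
    ; -‿homo = ⟦-⟧
    ; 0-homo = refl
    ; 1-homo = +-identityʳ 1#
    }

  coefficients≟ : ∀ i j → Maybe.Maybe (⟦ i ⟧ℤ ≈ ⟦ j ⟧ℤ)
  coefficients≟ i j = Maybe.map (λ i≡j → reflexive (≡.cong ⟦_⟧ℤ i≡j)) (dec⇒maybe (i ℤ.≟ j))

  open RingSolver ℤ.+-*-rawRing (fromCommutativeRing R) ℤ→R coefficients≟ public
    using (solve; _:=_; _:+_; _:-_; _:*_; :-_; con)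

-- Order and finite sums in an ordered field

module FieldLemmas {c ℓ₁ ℓ₂} (K : OrderedField c ℓ₁ ℓ₂) where

  open OrderedField K
  open SemiringSum semiring public
    using (sum; sum-cong-≋; ∑-distrib-+; ∑-comm; sum-replicate-zero; *-distribˡ-sum; *-distribʳ-sum)
  open IntegerCoefficients commutativeRing public
    using (solve; _:=_; _:+_; _:-_; _:*_; :-_; con)
  open RingProperties ring public using (-1*x≈-x)
  open AbelianGroupProperties +-abelianGroup public
    using () renaming (x≈y⇒x∙y⁻¹≈ε to x≈y⇒x-y≈0)
  private module O = IsDecTotalOrder isDecTotalOrder

  poset : Poset _ _ _
  poset = record { isPartialOrder = O.isPartialOrder }

  open PosetReasoning poset public

  -- Order

  ≤-refl : ∀ {x} → x ≤ x
  ≤-refl = O.reflexive refl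

  ≤-reflexive : ∀ {x y} → x ≈ y → x ≤ y
  ≤-reflexive = O.reflexive

  ≤-trans : ∀ {x y z} → x ≤ y → y ≤ z → x ≤ z
  ≤-trans = O.trans

  ≤-antisym : ∀ {x y} → x ≤ y → y ≤ x → x ≈ y
  ≤-antisym = O.antisym

  ≤-resp : ∀ {x x′ y y′} → x ≈ x′ → y ≈ y′ → x ≤ y → x′ ≤ y′
  ≤-resp p q r = ≤-trans (≤-reflexive (sym p)) (≤-trans r (≤-reflexive q))

  +-monoˡ-≤ : ∀ z {x y} → x ≤ y → x + z ≤ y + z
  +-monoˡ-≤ z p = ≤-resp (+-comm z _) (+-comm z _) (+-monoʳ-≤ z p)

  +-mono-≤ : ∀ {x y z w} → x ≤ y → z ≤ w → x + z ≤ y + w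
  +-mono-≤ p q = ≤-trans (+-monoˡ-≤ _ p) (+-monoʳ-≤ _ q)

  +-cancelʳ-≤ : ∀ z {x y} → x + z ≤ y + z → x ≤ y
  +-cancelʳ-≤ z p = ≤-resp (elim _) (elim _) (+-monoˡ-≤ (- z) p)
    where
    elim : ∀ x → x + z + - z ≈ x
    elim x = solve 2 (λ x z → x :+ z :+ :- z := x) refl x z

  neg-anti-≤ : ∀ {x y} → x ≤ y → - y ≤ - x
  neg-anti-≤ {x} {y} p = ≤-resp
    (solve 2 (λ x y → :- x :+ :- y :+ x := :- y) refl x y)
    (solve 2 (λ x y → :- x :+ :- y :+ y := :- x) refl x y)
    (+-monoʳ-≤ (- x + - y) p)

  *-monoʳ-≤ : ∀ {z x y} → 0# ≤ z → x ≤ y → z * x ≤ z * y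
  *-monoʳ-≤ {z} {x} {y} 0≤z p = ≤-resp
    (+-identityˡ _)
    (solve 3 (λ x y z → z :* (y :+ :- x) :+ z :* x := z :* y) refl x y z)
    (+-monoˡ-≤ (z * x) (*-nonNeg 0≤z
      (≤-resp (-‿inverseʳ x) refl (+-monoˡ-≤ (- x) p))))

  -- Finite sums

  sum-cong : ∀ {k} {g h : Fin k → Carrier} → (∀ i → g i ≈ h i) → sum g ≈ sum h
  sum-cong = sum-cong-≋

  sum-0 : ∀ {k} {g : Fin k → Carrier} → (∀ i → g i ≈ 0#) → sum g ≈ 0#
  sum-0 {k} p = trans (sum-cong p) (sum-replicate-zero k)

  sum-neg : ∀ {k} (g : Fin k → Carrier) → sum (λ i → - g i) ≈ - sum g
  sum-neg {k} g = begin-equality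
    sum (λ i → - g i)       ≈⟨ sum-cong {k} (λ i → sym (-1*x≈-x _)) ⟩
    sum (λ i → - 1# * g i)  ≈⟨ *-distribˡ-sum _ g ⟨
    - 1# * sum g            ≈⟨ -1*x≈-x _ ⟩
    - sum g                 ∎

  sum-sub : ∀ {k} (g h : Fin k → Carrier) → sum (λ i → g i - h i) ≈ sum g - sum h
  sum-sub g h = trans (∑-distrib-+ g (λ i → - h i)) (+-congˡ (sum-neg h))

  sum-mono : ∀ {k} {g h : Fin k → Carrier} → (∀ i → g i ≤ h i) → sum g ≤ sum h
  sum-mono {ℕ.zero}  p = ≤-refl
  sum-mono {ℕ.suc k} p = +-mono-≤ (p Fin.zero) (sum-mono (λ i → p (Fin.suc i)))

  sum-nonNeg : ∀ {k} {g : Fin k → Carrier} → (∀ i → 0# ≤ g i) → 0# ≤ sum g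
  sum-nonNeg {k} p = ≤-resp (sum-replicate-zero k) refl (sum-mono p)

  -- Termwise inequalities g ≤ h with sum h ≤ sum g are equalities.
  sum-tight : ∀ {k} {g h : Fin k → Carrier} → (∀ i → g i ≤ h i) →
              sum h ≤ sum g → ∀ i → h i ≈ g i
  sum-tight {ℕ.suc k} {g} {h} p q Fin.zero =
    ≤-antisym (+-cancelʳ-≤ _ (≤-trans q (+-monoʳ-≤ _ (sum-mono (λ i → p (Fin.suc i)))))) (p Fin.zero)
  sum-tight {ℕ.suc k} {g} {h} p q (Fin.suc i) = sum-tight (λ i → p (Fin.suc i))
    (+-cancelʳ-≤ (g Fin.zero) (≤-resp (+-comm _ _) (+-comm _ _)
      (≤-trans (+-monoˡ-≤ _ (p Fin.zero)) q))) i

  sum-single : ∀ {k} (g : Fin k → Carrier) i → (∀ j → j ≢ i → g j ≈ 0#) → sum g ≈ g i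
  sum-single g Fin.zero p =
    trans (+-congˡ (sum-0 (λ j → p (Fin.suc j) λ ()))) (+-identityʳ _)
  sum-single g (Fin.suc i) p = trans
    (+-cong (p Fin.zero λ ()) (sum-single (λ j → g (Fin.suc j)) i
      (λ j j≢i → p (Fin.suc j) λ { ≡.refl → j≢i ≡.refl })))
    (+-identityˡ _)

  -- Pairing of x with a linear combination of the vectors h j.
  sum-*-comm : ∀ {k l} (g : Fin k → Carrier) (h : Fin k → Fin l → Carrier) (x : Fin l → Carrier) →
    sum (λ s → sum (λ j → g j * h j s) * x s) ≈ sum (λ j → g j * sum (λ s → h j s * x s))
  sum-*-comm {k} {l} g h x = begin-equality
    sum (λ s → sum (λ j → g j * h j s) * x s)
      ≈⟨ sum-cong {l} (λ s → *-distribʳ-sum (x s) (λ j → g j * h j s)) ⟩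
    sum (λ s → sum (λ j → g j * h j s * x s))
      ≈⟨ ∑-comm (λ s j → g j * h j s * x s) ⟩
    sum (λ j → sum (λ s → g j * h j s * x s))
      ≈⟨ sum-cong {k} (λ j → trans (sum-cong {l} (λ s → *-assoc _ _ _))
           (sym (*-distribˡ-sum (g j) (λ s → h j s * x s)))) ⟩
    sum (λ j → g j * sum (λ s → h j s * x s)) ∎

  -- The indicator 1 or 0 of a decidable proposition.
  ind : ∀ {p} {P : Set p} → Dec P → Carrier
  ind P? = if does P? then 1# else 0#

  ind-true : ∀ {p} {P : Set p} (P? : Dec P) → P → ind P? ≈ 1#
  ind-true (yes _) _ = refl
  ind-true (no ¬p) p = contradiction p ¬p

  ind-false : ∀ {p} {P : Set p} (P? : Dec P) → ¬ P → ind P? ≈ 0#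
  ind-false (yes p) ¬p = contradiction p ¬p
  ind-false (no _)  _  = refl

  ind-≤ : ∀ {p} {P : Set p} (P? : Dec P) {x} → 0# ≤ x → (P → 1# ≤ x) → ind P? ≤ x
  ind-≤ (yes p) 0≤x 1≤x = 1≤x p
  ind-≤ (no _)  0≤x 1≤x = 0≤x

  ind-nonNeg : ∀ {p} {P : Set p} (P? : Dec P) → 0# ≤ ind P?
  ind-nonNeg (yes _) = 0≤1
  ind-nonNeg (no _)  = ≤-refl

  ind-≤1 : ∀ {p} {P : Set p} (P? : Dec P) → ind P? ≤ 1#
  ind-≤1 P? = ind-≤ P? 0≤1 (λ _ → ≤-refl)

  if-ind : ∀ {p} {P : Set p} (P? : Dec P) {x} → (if does P? then x else 0#) ≈ ind P? * x
  if-ind (yes _) = sym (*-identityˡ _)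
  if-ind (no _)  = sym (zeroˡ _)

  ind-cong : ∀ {p q} {P : Set p} {Q : Set q} (P? : Dec P) (Q? : Dec Q) →
             (P → Q) → (Q → P) → ind P? ≈ ind Q?
  ind-cong (yes p) Q? f g = sym (ind-true Q? (f p))
  ind-cong (no ¬p) Q? f g = sym (ind-false Q? (λ q → ¬p (g q)))

-- Subsets of finite sets

∈-tabulate⁺ : ∀ {k p} {P : Fin k → Set p} (P? : ∀ s → Dec (P s)) {s} →
              P s → s ∈ tabulate (λ s → does (P? s))
∈-tabulate⁺ P? {s} p = lookup⇒[]= s _ (≡.trans (lookup∘tabulate _ s) (dec-true (P? s) p))

∈-tabulate⁻ : ∀ {k p} {P : Fin k → Set p} (P? : ∀ s → Dec (P s)) {s} →
              s ∈ tabulate (λ s → does (P? s)) → P s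
∈-tabulate⁻ P? {s} s∈ with P? s | ≡.trans (≡.sym (lookup∘tabulate (λ s → does (P? s)) s)) ([]=⇒lookup s∈)
... | yes p | _  = p
... | no _  | ()

x∈p─q⇒x∉q : ∀ {k} {x : Fin k} (p q : Subset k) → x ∈ p ─ q → x ∉ q
x∈p─q⇒x∉q (_ ∷ p) (outside ∷ q) (there x∈) (there x∈q) = x∈p─q⇒x∉q p q x∈ x∈q
x∈p─q⇒x∉q (_ ∷ p) (inside  ∷ q) (there x∈) (there x∈q) = x∈p─q⇒x∉q p q x∈ x∈q

∣p∣≤1⇒unique : ∀ {k} {p : Subset k} {x y} → ∣ p ∣ ℕ.≤ 1 → x ∈ p → y ∈ p → x ≡ y
∣p∣≤1⇒unique {p = p} {x} {y} ∣p∣≤1 x∈p y∈p with x Fin.≟ y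
... | yes x≡y = x≡y
... | no  x≢y = contradiction (ℕ.≤-trans ∣⁅y⁆∣<∣p∣ ∣p∣≤1) (ℕ.<-irrefl ≡.refl)
  where
  ⁅y⁆⊂p : ⁅ y ⁆ ⊂ p
  ⁅y⁆⊂p = (λ z∈ → ≡.subst (_∈ p) (≡.sym (x∈⁅y⁆⇒x≡y y z∈)) y∈p) , x , x∈p , x≢y⇒x∉⁅y⁆ x≢y
  ∣⁅y⁆∣<∣p∣ : 2 ℕ.≤ ∣ p ∣
  ∣⁅y⁆∣<∣p∣ = ≡.subst (ℕ._< ∣ p ∣) (∣⁅x⁆∣≡1 y) (p⊂q⇒∣p∣<∣q∣ ⁅y⁆⊂p)

-- Of an increasing family, every nonempty set S has an element that lies only
-- in those members that contain S.  A pivot s for the tail of the family fails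
-- for the whole family only if s ∈ A 0 and S ⊈ A 0; then every later member
-- contains s, hence S, and any element of S outside A 0 is a pivot.
pivot : ∀ {k m} {S : Subset m} (A : Fin k → Subset m) → (∀ {i j} → i Fin.< j → A i ⊆ A j) →
        Nonempty S → ∃ λ s → s ∈ S × ∀ j → s ∈ A j → S ⊆ A j
pivot {ℕ.zero}  A mono (s , s∈S) = s , s∈S , λ ()
pivot {ℕ.suc k} {S = S} A mono ne@(r , r∈S)
  with S ⊆? A Fin.zero | pivot (λ j → A (Fin.suc j)) (λ i<j → mono (ℕ.s≤s i<j)) ne
... | yes S⊆A₀ | _ = r , r∈S , λ where
  Fin.zero    _ → S⊆A₀
  (Fin.suc j) _ → mono {Fin.zero} {Fin.suc j} (ℕ.s≤s ℕ.z≤n) ∘ S⊆A₀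
... | no S⊈A₀ | s , s∈S , minimal with s ∈? A Fin.zero
...   | no s∉A₀ = s , s∈S , λ where
  Fin.zero    s∈A₀ → contradiction s∈A₀ s∉A₀
  (Fin.suc j) s∈Aⱼ → minimal j s∈Aⱼ
...   | yes s∈A₀ with Fin.any? (λ t → (t ∈? S) ×-dec ¬? (t ∈? A Fin.zero))
...     | yes (t , t∈S , t∉A₀) = t , t∈S , λ where
  Fin.zero    t∈A₀ → contradiction t∈A₀ t∉A₀
  (Fin.suc j) _    → minimal j (mono {Fin.zero} {Fin.suc j} (ℕ.s≤s ℕ.z≤n) s∈A₀)
...     | no none = contradiction (λ {t} → within t) S⊈A₀
  where
  within : ∀ t → t ∈ S → t ∈ A Fin.zero
  within t t∈S with t ∈? A Fin.zero
  ... | yes t∈ = t∈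
  ... | no t∉  = contradiction (t , t∈S , t∉) none

mapChain : ∀ {m p q} {P : Pred (Subset m) p} {Q : Pred (Subset m) q} →
           (∀ {S} → P S → Q S) → Chain P → Chain Q
mapChain P⇒Q C = record
  { length = length ; set = set ; member = λ j → P⇒Q (member j) ; increasing = increasing }
  where open Chain C

1≤∣p∣⇒nonempty : ∀ {k} {p : Subset k} → 1 ℕ.≤ ∣ p ∣ → Nonempty p
1≤∣p∣⇒nonempty {k} {p} 1≤∣p∣ with nonempty? p
... | yes ne = ne
... | no  ¬ne = contradiction
  (≡.subst (1 ℕ.≤_) (≡.trans (≡.cong ∣_∣ (Empty-unique ¬ne)) (∣⊥∣≡0 k)) 1≤∣p∣) λ ()

module FanProperties {c ℓ₁ ℓ₂} (K : OrderedField c ℓ₁ ℓ₂) {m n} (π : Fin m → Fin n)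
           (π-surjective : Surjective _≡_ _≡_ π) where

  open OrderedField K
  open ColoredFan K π π-surjective
  open FieldLemmas K

  -- Pairings and indicator vectors

  ·-cong : ∀ {u v x y : V} → (∀ s → u s ≈ v s) → (∀ s → x s ≈ y s) → u · x ≈ v · y
  ·-cong p q = sum-cong {m} (λ s → *-cong (p s) (q s))

  ·-congˡ : ∀ (u : V) {x y : V} → (∀ s → x s ≈ y s) → u · x ≈ u · y
  ·-congˡ u = ·-cong {u} (λ _ → refl)

  ·-comm : ∀ (u x : V) → u · x ≈ x · u
  ·-comm u x = sum-cong {m} (λ s → *-comm (u s) (x s))

  ·-+ : ∀ (u x y : V) → u · (λ s → x s + y s) ≈ u · x + u · y
  ·-+ u x y = trans (sum-cong {m} (λ s → distribˡ (u s) (x s) (y s)))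
                    (∑-distrib-+ {m} (λ s → u s * x s) (λ s → u s * y s))

  ·-neg : ∀ (u x : V) → u · (λ s → - x s) ≈ - (u · x)
  ·-neg u x = trans
    (sum-cong {m} (λ s → solve 2 (λ a b → a :* :- b := :- (a :* b)) refl (u s) (x s)))
    (sum-neg {m} (λ s → u s * x s))

  ·-sub : ∀ (u x y : V) → u · (λ s → x s - y s) ≈ u · x - u · y
  ·-sub u x y = trans (·-+ u x (λ s → - y s)) (+-congˡ (·-neg u y))

  ·-single : ∀ (u x : V) t → (∀ s → s ≢ t → u s * x s ≈ 0#) → u · x ≈ u t * x t
  ·-single u x t = sum-single {m} (λ s → u s * x s) t

  ·-nonNeg : ∀ {u x : V} → (∀ s → 0# ≤ u s) → (∀ s → 0# ≤ x s) → 0# ≤ u · x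
  ·-nonNeg p q = sum-nonNeg {m} (λ s → *-nonNeg (p s) (q s))

  ·-mono : ∀ {u v x : V} → (∀ s → 0# ≤ x s) → (∀ s → u s ≤ v s) → u · x ≤ v · x
  ·-mono {u} {v} {x} p q = sum-mono {m} (λ s →
    ≤-resp (*-comm (x s) (u s)) (*-comm (x s) (v s)) (*-monoʳ-≤ (p s) (q s)))

  ∑∈-ind : ∀ {k} (J : Subset k) (g : Fin k → Carrier) →
           ∑∈ J g ≈ sum (λ j → ind (j ∈? J) * g j)
  ∑∈-ind {k} J g = sum-cong {k} (λ j → if-ind (j ∈? J))

  ∑∈≈e· : ∀ (S : Subset m) (x : V) → ∑∈ S x ≈ e S · x
  ∑∈≈e· S x = ∑∈-ind S x

  e-in : ∀ {S s} → s ∈ S → e S s ≈ 1#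
  e-in {S} {s} = ind-true (s ∈? S)

  e-out : ∀ {S s} → s ∉ S → e S s ≈ 0#
  e-out {S} {s} = ind-false (s ∈? S)

  e-nonNeg : ∀ S s → 0# ≤ e S s
  e-nonNeg S s = ind-nonNeg (s ∈? S)

  e⁅⁆· : ∀ t (x : V) → e ⁅ t ⁆ · x ≈ x t
  e⁅⁆· t x = trans
    (·-single (e ⁅ t ⁆) x t (λ s s≢t → trans (*-congʳ (e-out (x≢y⇒x∉⁅y⁆ s≢t))) (zeroˡ _)))
    (trans (*-congʳ (e-in (x∈⁅x⁆ t))) (*-identityˡ _))

  ∈E⁺ : ∀ {s i} → π s ≡ i → s ∈ E i
  ∈E⁺ {i = i} = ∈-tabulate⁺ (λ s → π s Fin.≟ i)

  ∈E⁻ : ∀ {s i} → s ∈ E i → π s ≡ i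
  ∈E⁻ {i = i} = ∈-tabulate⁻ (λ s → π s Fin.≟ i)

  ∈I⁺ : ∀ {S s} → s ∈ S → π s ∈ I S
  ∈I⁺ {S} {s} s∈S = ∈-tabulate⁺ (λ i → nonempty? (S ∩ E i)) (s , x∈p∩q⁺ (s∈S , ∈E⁺ ≡.refl))

  ∈I⁻ : ∀ {S i} → i ∈ I S → ∃ λ s → s ∈ S × π s ≡ i
  ∈I⁻ {S} {i} i∈I with ∈-tabulate⁻ (λ i → nonempty? (S ∩ E i)) i∈I
  ... | s , s∈ = let s∈S , s∈E = x∈p∩q⁻ S (E i) s∈ in s , s∈S , ∈E⁻ s∈E

  -- The set E j minus its part avoiding S is the part of S of colour j.
  ∈E─Ē⁻ : ∀ {S j s} → s ∈ E j ─ Ē S j → s ∈ S × π s ≡ j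
  ∈E─Ē⁻ {S} {j} {s} s∈ with s ∈? S
  ... | yes s∈S = s∈S , ∈E⁻ (p─q⊆p (E j) (Ē S j) s∈)
  ... | no  s∉S = contradiction
    (x∈p∧x∉q⇒x∈p─q (p─q⊆p (E j) (Ē S j) s∈) (s∉S ∘ proj₁ ∘ x∈p∩q⁻ S (E j)))
    (x∈p─q⇒x∉q (E j) (Ē S j) s∈)

  ∈E─Ē⁺ : ∀ {S j s} → s ∈ S → π s ≡ j → s ∈ E j ─ Ē S j
  ∈E─Ē⁺ {S} {j} {s} s∈S πs≡j = x∈p∧x∉q⇒x∈p─q (∈E⁺ πs≡j) λ s∈Ē →
    x∈p─q⇒x∉q (E j) (S ∩ E j) s∈Ē (x∈p∩q⁺ (s∈S , ∈E⁺ πs≡j))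

  colored-unique : ∀ {S} → IsColored S → ∀ {s t} → s ∈ S → t ∈ S → π s ≡ π t → s ≡ t
  colored-unique {S} col {s} {t} s∈S t∈S πs≡πt = ∣p∣≤1⇒unique (col (π t))
    (x∈p∩q⁺ (s∈S , ∈E⁺ πs≡πt)) (x∈p∩q⁺ (t∈S , ∈E⁺ ≡.refl))

  ⊆-colored : ∀ {S R} → S ⊆ R → IsColored R → IsColored S
  ⊆-colored {S} {R} S⊆R col i = ℕ.≤-trans (p⊆q⇒∣p∣≤∣q∣ (λ s∈ →
    let s∈S , s∈E = x∈p∩q⁻ S (E i) s∈ in x∈p∩q⁺ (S⊆R s∈S , s∈E))) (col i)

  ⁅⁆-colored : ∀ s → IsColored ⁅ s ⁆
  ⁅⁆-colored s i = ℕ.≤-trans (∣p∩q∣≤∣p∣ ⁅ s ⁆ (E i)) (ℕ.≤-reflexive (∣⁅x⁆∣≡1 s))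

  -- Pairing with points congruent to a combination of indicator vectors

  combination-· : ∀ {p} {P : Pred (Subset m) p} (C : Chain P) coef (x : V) →
    combination C coef · x ≈ sum (λ j → coef j * (e (Chain.set C j) · x))
  combination-· C coef x = sum-*-comm {Chain.length C} {m} coef (λ j → e (Chain.set C j)) x

  L-· : ∀ {u v : V} (u≡v : u ≡L v) (x : V) →
        u · x ≈ v · x + sum (λ i → proj₁ u≡v i * (e (E i) · x))
  L-· {u} {v} (b , u-v≈) x = begin-equality
    u · x
      ≈⟨ ·-comm u x ⟩
    x · u
      ≈⟨ ·-congˡ x (λ s → trans
           (solve 2 (λ a b → a := b :+ (a :- b)) refl (u s) (v s)) (+-congˡ (u-v≈ s))) ⟩
    x · (λ s → v s + sum (λ i → b i * e (E i) s))
      ≈⟨ ·-+ x v _ ⟩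
    x · v + x · (λ s → sum (λ i → b i * e (E i) s))
      ≈⟨ +-cong (·-comm x v) (trans (·-comm x _) (sum-*-comm {n} {m} b (λ i → e (E i)) x)) ⟩
    v · x + sum (λ i → b i * (e (E i) · x)) ∎

  ≡L-refl : ∀ {u} → u ≡L u
  ≡L-refl {u} = (λ _ → 0#) , λ s →
    trans (-‿inverseʳ (u s)) (sym (sum-0 {n} (λ i → zeroˡ _)))

  -- Proper sets and adapted regions

  -- A set containing no whole colour class.  If every colour class has at least
  -- two elements, colored sets are proper, and so are the sets of rays of the
  -- normal cones of Δ(E).
  Proper : Pred (Subset m) _
  Proper R = ∀ i → ∃ λ t → π t ≡ i × t ∉ R

  -- An element outside the largest member of a chain lies outside all members.
  avoiding : (C : Chain Proper) → ∀ i → ∃ λ t → π t ≡ i × ∀ j → t ∉ Chain.set C j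
  avoiding record { length = ℕ.zero } i = proj₁ (π-surjective i) , proj₂ (π-surjective i) ≡.refl , λ ()
  avoiding record { length = ℕ.suc k ; set = set ; member = member ; increasing = increasing } i =
    let t , πt≡i , t∉top = member (Fin.fromℕ k) i
    in  t , πt≡i , λ j t∈ → t∉top (below-top j t∈)
    where
    below-top : ∀ j → set j ⊆ set (Fin.fromℕ k)
    below-top j with j Fin.≟ Fin.fromℕ k
    ... | yes ≡.refl = λ t∈ → t∈
    ... | no  j≢k    = proj₁ (increasing (Fin.≤∧≢⇒< (Fin.≤fromℕ j) j≢k))

  -- On an adapted region the functional e_R is bounded below by φ R, these
  -- bounds are attained simultaneously along each chain of proper sets, and
  -- e_{E_i} is constant with value κ i.
  record Adapted (Q : Region) (φ : Subset m → Carrier) (κ : Fin n → Carrier) : Set (c ⊔ ℓ₁ ⊔ ℓ₂) where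
    field
      lower    : ∀ R x → Q x → φ R ≤ e R · x
      attained : ∀ (C : Chain Proper) → ∃ λ y → Q y × ∀ j → e (Chain.set C j) · y ≈ φ (Chain.set C j)
      level    : ∀ i x → Q x → e (E i) · x ≈ κ i

  module _ {Q φ κ} (adapted : Adapted Q φ κ) (C : Chain Proper) where

    open Adapted adapted
    open Chain C

    adapted-value : ∀ {u coef} (u≡ : u ≡L combination C coef) x → Q x →
      u · x ≈ sum (λ j → coef j * (e (set j) · x)) + sum (λ i → proj₁ u≡ i * κ i)
    adapted-value {u} {coef} u≡ x Qx = trans (L-· u≡ x) (+-cong
      (combination-· C coef x) (sum-cong {n} (λ i → *-congˡ (level i x Qx))))

    -- The second sum is the value of the component of u in L(E), a functional
    -- that is constant on the region.
    adapted-min : ∀ {u coef} → (∀ j → 0# ≤ coef j) → (u≡ : u ≡L combination C coef) →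
      IsMin Q u (sum (λ j → coef j * φ (set j)) + sum (λ i → proj₁ u≡ i * κ i))
    adapted-min {u} {coef} coef≥0 u≡ =
      (let y , Qy , tight = attained C in
       y , Qy , trans (adapted-value u≡ y Qy) (+-congʳ (sum-cong {length} (λ j → *-congˡ (tight j))))) ,
      λ x Qx → ≤-resp refl (sym (adapted-value u≡ x Qx))
        (+-monoˡ-≤ _ (sum-mono {length} (λ j → *-monoʳ-≤ (coef≥0 j) (lower (set j) x Qx))))

  -- A minimiser of the sum of the e_R along a chain minimises each e_R, and
  -- hence every u in the cone spanned by the e_R and L(E).
  adapted-coarsens : ∀ {Q φ κ} → Adapted Q φ κ → (C : Chain Proper) → ∃ λ v → ∃ (Face Q v) ×
    (∀ u → (∃ λ coef → (∀ j → 0# ≤ coef j) × u ≡L combination C coef) → NormalCone Q v u)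
  adapted-coarsens {Q} {φ} {κ} adapted C =
    let y , Qy , tight = attained C
        v = combination C (λ _ → 1#)
        v-value = λ x → trans (combination-· C (λ _ → 1#) x) (sum-cong {length} (λ j → *-identityˡ _))
        v-y = trans (v-value y) (sum-cong {length} tight)
    in v , (y , Qy , λ x Qx → ≤-resp (sym v-y) (sym (v-value x))
              (sum-mono {length} (λ j → lower (set j) x Qx))) ,
       λ u (coef , coef≥0 , u≡) x (Qx , x-min) →
         let x-tight = sum-tight {length} (λ j → lower (set j) x Qx)
               (≤-resp (v-value x) v-y (x-min y Qy))
         in Qx , λ z Qz → ≤-resp
              (sym (trans (adapted-value adapted C u≡ x Qx)
                 (+-congʳ (sum-cong {length} (λ j → *-congˡ (x-tight j))))))
              refl (proj₂ (adapted-min adapted C coef≥0 u≡) z Qz)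
    where
    open Adapted adapted
    open Chain C

  adapted-⇔ : ∀ {Q Q′ φ κ} → (∀ x → Q x ⇔ Q′ x) → Adapted Q φ κ → Adapted Q′ φ κ
  adapted-⇔ Q⇔Q′ adapted = record
    { lower    = λ R x Q′x → lower R x (from (Q⇔Q′ x) Q′x)
    ; attained = λ C → let y , Qy , tight = attained C in y , to (Q⇔Q′ y) Qy , tight
    ; level    = λ i x Q′x → level i x (from (Q⇔Q′ x) Q′x)
    }
    where open Adapted adapted

  -- Invariance of a region under pointwise equality.
  Extensional : Region → Set _
  Extensional Q = ∀ {x y} → (∀ s → x s ≈ y s) → Q x → Q y

  adapted-translate : ∀ {Q φ κ} v → Extensional Q → Adapted Q φ κ →
    Adapted (translate Q v) (λ R → φ R - e R · v) (λ i → κ i - e (E i) · v)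
  adapted-translate {Q} {φ} {κ} v ext adapted = record
    { lower    = λ R x Qx → ≤-resp refl (shift R x) (+-monoˡ-≤ (- (e R · v)) (lower R _ Qx))
    ; attained = λ C → let y , Qy , tight = attained C in
        (λ s → y s - v s) ,
        ext (λ s → solve 2 (λ a b → a := a :- b :+ b) refl (y s) (v s)) Qy ,
        λ j → trans (·-sub (e (Chain.set C j)) y v) (+-congʳ (tight j))
    ; level    = λ i x Qx → trans (sym (shift (E i) x)) (+-congʳ (level i _ Qx))
    }
    where
    open Adapted adapted
    shift : ∀ R (x : V) → e R · (λ s → x s + v s) - e R · v ≈ e R · x
    shift R x = trans (+-congʳ (·-+ (e R) x v))
      (solve 2 (λ a b → a :+ b :- b := a) refl (e R · x) (e R · v))

  -- Products of simplices and their truncations by inequalities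

  simplex-⇔ : ∀ S x → Simplex S x ⇔ ((∀ s → 0# ≤ x s) × (∀ s → s ∉ S → x s ≈ 0#) × sum x ≈ 1#)
  simplex-⇔ S x = mk⇔
    (λ (w , w≥0 , w-off , ∑w , x≈) →
      let x≈w = λ t → trans (x≈ t) (coordinate w t) in
      (λ s → ≤-resp refl (sym (x≈w s)) (w≥0 s)) , (λ s s∉S → trans (x≈w s) (w-off s s∉S)) ,
      trans (sum-cong {m} x≈w) ∑w)
    (λ (x≥0 , x-off , ∑x) → x , x≥0 , x-off , ∑x , λ t → sym (coordinate x t))
    where
    coordinate : ∀ (w : V) t → sum (λ s → w s * e ⁅ s ⁆ t) ≈ w t
    coordinate w t = begin-equality
      sum (λ s → w s * e ⁅ s ⁆ t)  ≈⟨ sum-single {m} _ t (λ s s≢t →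
          trans (*-congˡ (e-out (x≢y⇒x∉⁅y⁆ (s≢t ∘ ≡.sym)))) (zeroʳ _)) ⟩
      w t * e ⁅ t ⁆ t              ≈⟨ *-congˡ (e-in (x∈⁅x⁆ t)) ⟩
      w t * 1#                     ≈⟨ *-identityʳ _ ⟩
      w t                          ∎

  -- Description of Δ J E by linear conditions: nonnegative coordinates, with sum
  -- 1 over the colours in J and 0 over the others.  The coordinates of a colour
  -- outside J then vanish.
  InΔ : Subset n → V → Set (ℓ₁ ⊔ ℓ₂)
  InΔ J x = (∀ s → 0# ≤ x s) × (∀ i → e (E i) · x ≈ ind (i ∈? J))

  InΔ-off : ∀ {J x} → InΔ J x → ∀ {s} → π s ∉ J → x s ≈ 0#
  InΔ-off {J} {x} (x≥0 , level) {s} πs∉J = begin-equality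
    x s                  ≈⟨ *-identityˡ _ ⟨
    1# * x s             ≈⟨ *-congʳ (e-in (∈E⁺ {s} ≡.refl)) ⟨
    e (E (π s)) s * x s  ≈⟨ sum-tight {m} {λ _ → 0#} {λ t → e (E (π s)) t * x t}
                              (λ t → *-nonNeg (e-nonNeg (E (π s)) t) (x≥0 t))
                              (≤-reflexive (trans (trans (level (π s)) (ind-false (π s ∈? J) πs∉J))
                                (sym (sum-0 {m} (λ _ → refl))))) s ⟩
    0#                   ∎

  Δ-⇔ : ∀ J x → Δ J E x ⇔ InΔ J x
  Δ-⇔ J x = mk⇔ forward backward
    where
    forward : Δ J E x → InΔ J x
    forward (y , y∈ , x≈) =
      (λ s → ≤-resp refl (sym (trans (x≈ s) (∑∈-ind J (λ j → y j s))))
        (sum-nonNeg {n} (λ j → summand≥0 s j))) ,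
      λ i → begin-equality
        e (E i) · x
          ≈⟨ ·-comm (e (E i)) x ⟩
        x · e (E i)
          ≈⟨ ·-cong {x} (λ s → trans (x≈ s) (∑∈-ind J (λ j → y j s))) (λ s → refl) ⟩
        (λ s → sum (λ j → ind (j ∈? J) * y j s)) · e (E i)
          ≈⟨ sum-*-comm {n} {m} (λ j → ind (j ∈? J)) y (e (E i)) ⟩
        sum (λ j → ind (j ∈? J) * (y j · e (E i)))
          ≈⟨ sum-single {n} _ i (other i) ⟩
        ind (i ∈? J) * (y i · e (E i))
          ≈⟨ same i ⟩
        ind (i ∈? J) ∎
      where
      summand≥0 : ∀ s j → 0# ≤ ind (j ∈? J) * y j s
      summand≥0 s j with j ∈? J
      ... | yes j∈J = ≤-resp refl (sym (*-identityˡ _)) (proj₁ (to (simplex-⇔ (E j) (y j)) (y∈ j j∈J)) s)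
      ... | no  _   = ≤-reflexive (sym (zeroˡ _))
      other : ∀ i j → j ≢ i → ind (j ∈? J) * (y j · e (E i)) ≈ 0#
      other i j j≢i with j ∈? J
      ... | no  _   = zeroˡ _
      ... | yes j∈J = trans (*-identityˡ _) (sum-0 {m} term)
        where
        term : ∀ s → y j s * e (E i) s ≈ 0#
        term s with s ∈? E i
        ... | no  _    = zeroʳ _
        ... | yes s∈Ei = trans (*-congʳ (proj₁ (proj₂ (to (simplex-⇔ (E j) (y j)) (y∈ j j∈J))) s
                (λ s∈Ej → j≢i (≡.trans (≡.sym (∈E⁻ s∈Ej)) (∈E⁻ s∈Ei))))) (zeroˡ _)
      same : ∀ i → ind (i ∈? J) * (y i · e (E i)) ≈ ind (i ∈? J)
      same i with i ∈? J
      ... | no  _   = zeroˡ _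
      ... | yes i∈J = trans (*-identityˡ _) (trans (sum-cong {m} term) ∑y)
        where
        off = proj₁ (proj₂ (to (simplex-⇔ (E i) (y i)) (y∈ i i∈J)))
        ∑y  = proj₂ (proj₂ (to (simplex-⇔ (E i) (y i)) (y∈ i i∈J)))
        term : ∀ s → y i s * e (E i) s ≈ y i s
        term s with s ∈? E i
        ... | yes _   = *-identityʳ _
        ... | no s∉Ei = trans (zeroʳ _) (sym (off s s∉Ei))

    backward : InΔ J x → Δ J E x
    backward x∈@(x≥0 , level) = part ,
      (λ j j∈J → from (simplex-⇔ (E j) (part j))
        ((λ s → *-nonNeg (e-nonNeg (E j) s) (x≥0 s)) ,
         (λ s s∉ → trans (*-congʳ (e-out s∉)) (zeroˡ _)) ,
         trans (level j) (ind-true (j ∈? J) j∈J))) ,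
      λ s → sym (begin-equality
        ∑∈ J (λ j → part j s)                 ≈⟨ ∑∈-ind J (λ j → part j s) ⟩
        sum (λ j → ind (j ∈? J) * part j s)   ≈⟨ sum-single {n} _ (π s) (λ j j≢πs →
            trans (*-congˡ (trans (*-congʳ (e-out (j≢πs ∘ ≡.sym ∘ ∈E⁻))) (zeroˡ _))) (zeroʳ _)) ⟩
        ind (π s ∈? J) * part (π s) s         ≈⟨ *-congˡ (trans (*-congʳ (e-in (∈E⁺ {s} ≡.refl))) (*-identityˡ _)) ⟩
        ind (π s ∈? J) * x s                  ≈⟨ own s ⟩
        x s                                   ∎)
      where
      part : Fin n → V
      part j s = e (E j) s * x s
      own : ∀ s → ind (π s ∈? J) * x s ≈ x s
      own s with π s ∈? J
      ... | yes _   = *-identityˡ _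
      ... | no πs∉J = trans (zeroˡ _) (sym (InΔ-off {J} x∈ πs∉J))

  simplex-Δ : ∀ i x → Simplex (E i) x ⇔ InΔ ⁅ i ⁆ x
  simplex-Δ i x = mk⇔
    (λ x∈ → let x≥0 , off , ∑x = to (simplex-⇔ (E i) x) x∈ in x≥0 , λ j → level off ∑x j)
    (λ x∈@(x≥0 , level) → from (simplex-⇔ (E i) x)
      (x≥0 ,
       (λ s s∉ → InΔ-off {⁅ i ⁆} x∈ (s∉ ∘ ∈E⁺ ∘ x∈⁅y⁆⇒x≡y i)) ,
       trans (sum-cong {m} (λ s → sym (concentrated
           (λ s s∉ → InΔ-off {⁅ i ⁆} x∈ (s∉ ∘ ∈E⁺ ∘ x∈⁅y⁆⇒x≡y i)) s)))
         (trans (level i) (ind-true (i ∈? ⁅ i ⁆) (x∈⁅x⁆ i)))))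
    where
    concentrated : (∀ s → s ∉ E i → x s ≈ 0#) → ∀ s → e (E i) s * x s ≈ x s
    concentrated off s with s ∈? E i
    ... | yes _ = *-identityˡ _
    ... | no s∉ = trans (zeroˡ _) (sym (off s s∉))
    level : (∀ s → s ∉ E i → x s ≈ 0#) → sum x ≈ 1# → ∀ j → e (E j) · x ≈ ind (j ∈? ⁅ i ⁆)
    level off ∑x j with j ∈? ⁅ i ⁆
    ... | yes j∈ rewrite x∈⁅y⁆⇒x≡y i j∈ = trans (sum-cong {m} (concentrated off)) ∑x
    ... | no  j∉ = sum-0 {m} λ s → term s
      where
      term : ∀ s → e (E j) s * x s ≈ 0#
      term s with s ∈? E j
      ... | no  _   = zeroˡ _
      ... | yes s∈Ej = trans (*-congˡ (off s (λ s∈Ei →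
              j∉ (≡.subst (_∈ ⁅ i ⁆) (≡.trans (≡.sym (∈E⁻ s∈Ei)) (∈E⁻ s∈Ej)) (x∈⁅x⁆ i))))) (zeroʳ _)

  -- The functional defining the truncation is the sum of the coordinates in S.
  truncation-sum : ∀ {S J} → I S ⊆ J → ∀ (x : V) →
    ∑∈ J (λ j → ∑∈ (E j ─ Ē S j) x) ≈ e S · x
  truncation-sum {S} {J} IS⊆J x = begin-equality
    ∑∈ J (λ j → ∑∈ (E j ─ Ē S j) x)
      ≈⟨ ∑∈-ind J _ ⟩
    sum (λ j → ind (j ∈? J) * ∑∈ (E j ─ Ē S j) x)
      ≈⟨ sum-cong {n} (λ j → *-congˡ (∑∈≈e· (E j ─ Ē S j) x)) ⟩
    sum (λ j → ind (j ∈? J) * (e (E j ─ Ē S j) · x))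
      ≈⟨ sum-*-comm {n} {m} (λ j → ind (j ∈? J)) (λ j → e (E j ─ Ē S j)) x ⟨
    (λ s → sum (λ j → ind (j ∈? J) * e (E j ─ Ē S j) s)) · x
      ≈⟨ ·-cong {y = x} coefficient (λ _ → refl) ⟩
    e S · x ∎
    where
    coefficient : ∀ s → sum (λ j → ind (j ∈? J) * e (E j ─ Ē S j) s) ≈ e S s
    coefficient s with s ∈? S
    ... | no s∉S = sum-0 {n} λ j →
      trans (*-congˡ (e-out {E j ─ Ē S j} (s∉S ∘ proj₁ ∘ ∈E─Ē⁻))) (zeroʳ _)
    ... | yes s∈S = begin-equality
      sum (λ j → ind (j ∈? J) * e (E j ─ Ē S j) s)
        ≈⟨ sum-single {n} _ (π s) (λ j j≢πs → trans (*-congˡ (e-out {E j ─ Ē S j}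
             (j≢πs ∘ ≡.sym ∘ proj₂ ∘ ∈E─Ē⁻ {S}))) (zeroʳ _)) ⟩
      ind (π s ∈? J) * e (E (π s) ─ Ē S (π s)) s
        ≈⟨ *-cong (ind-true (π s ∈? J) (IS⊆J (∈I⁺ s∈S))) (e-in (∈E─Ē⁺ s∈S ≡.refl)) ⟩
      1# * 1#
        ≈⟨ *-identityˡ _ ⟩
      1# ∎

  DTr-⇔ : ∀ {S J} → I S ⊆ J → ∀ x → DTr J E (Ē S) x ⇔ (InΔ J x × 1# ≤ e S · x)
  DTr-⇔ {S} {J} IS⊆J x = mk⇔
    (λ (x∈ , 1≤) → to (Δ-⇔ J x) x∈ , ≤-resp refl (truncation-sum IS⊆J x) 1≤)
    (λ (x∈ , 1≤) → from (Δ-⇔ J x) x∈ , ≤-resp refl (sym (truncation-sum IS⊆J x)) 1≤)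

  InΔ-ext : ∀ {J x y} → (∀ s → x s ≈ y s) → InΔ J x → InΔ J y
  InΔ-ext x≈y (x≥0 , level) =
    (λ s → ≤-resp refl (x≈y s) (x≥0 s)) ,
    λ i → trans (·-congˡ (e (E i)) (λ s → sym (x≈y s))) (level i)

  simplex-ext : ∀ i → Extensional (Simplex (E i))
  simplex-ext i {x} {y} x≈y x∈ = from (simplex-Δ i y) (InΔ-ext {⁅ i ⁆} x≈y (to (simplex-Δ i x) x∈))

  DTr-ext : ∀ {S J} → I S ⊆ J → Extensional (DTr J E (Ē S))
  DTr-ext {S} {J} IS⊆J {x} {y} x≈y x∈ = let x∈Δ , 1≤ = to (DTr-⇔ IS⊆J x) x∈ in
    from (DTr-⇔ IS⊆J y) (InΔ-ext {J} x≈y x∈Δ , ≤-resp refl (·-congˡ (e S) x≈y) 1≤)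

  -- Vertices and minima over the regions

  -- The vertex of Δ J E given by a choice of one element τ i of each colour i.
  vertex : Subset n → (Fin n → Fin m) → V
  vertex J τ s = ind (π s ∈? J) * ind (s Fin.≟ τ (π s))

  module _ {J : Subset n} {τ : Fin n → Fin m} (πτ : ∀ i → π (τ i) ≡ i) where

    vertex-nonNeg : ∀ s → 0# ≤ vertex J τ s
    vertex-nonNeg s = *-nonNeg (ind-nonNeg (π s ∈? J)) (ind-nonNeg (s Fin.≟ τ (π s)))

    vertex-off : ∀ {s} → s ≢ τ (π s) → vertex J τ s ≈ 0#
    vertex-off {s} s≢ = trans (*-congˡ (ind-false (s Fin.≟ τ (π s)) s≢)) (zeroʳ _)

    vertex-on : ∀ i → vertex J τ (τ i) ≈ ind (i ∈? J)
    vertex-on i = trans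
      (*-cong (reflexive (≡.cong (λ j → ind (j ∈? J)) (πτ i)))
              (ind-true (τ i Fin.≟ τ (π (τ i))) (≡.cong τ (≡.sym (πτ i)))))
      (*-identityʳ _)

    vertex∈Δ : InΔ J (vertex J τ)
    vertex∈Δ = vertex-nonNeg , λ i → begin-equality
      e (E i) · vertex J τ               ≈⟨ ·-single (e (E i)) (vertex J τ) (τ i) (other i) ⟩
      e (E i) (τ i) * vertex J τ (τ i)   ≈⟨ *-cong (e-in (∈E⁺ (πτ i))) (vertex-on i) ⟩
      1# * ind (i ∈? J)                  ≈⟨ *-identityˡ _ ⟩
      ind (i ∈? J)                       ∎
      where
      other : ∀ i s → s ≢ τ i → e (E i) s * vertex J τ s ≈ 0#
      other i s s≢ with s ∈? E i
      ... | no _   = zeroˡ _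
      ... | yes s∈ = trans (*-congˡ (vertex-off λ s≡ → s≢ (≡.trans s≡ (≡.cong τ (∈E⁻ s∈))))) (zeroʳ _)

    vertex-avoiding : ∀ {R} → (∀ i → τ i ∉ R) → e R · vertex J τ ≈ 0#
    vertex-avoiding {R} τ∉R = sum-0 {m} term
      where
      term : ∀ s → e R s * vertex J τ s ≈ 0#
      term s with s ∈? R
      ... | no  _   = zeroˡ _
      ... | yes s∈R = trans (*-congˡ (vertex-off λ s≡ → τ∉R (π s) (≡.subst (_∈ R) s≡ s∈R))) (zeroʳ _)

    vertex-avoiding-except : ∀ {R i} → i ∈ J → (∀ j → j ≢ i → τ j ∉ R) → e R · vertex J τ ≈ e R (τ i)
    vertex-avoiding-except {R} {i} i∈J τ∉R = begin-equality
      e R · vertex J τ              ≈⟨ ·-single (e R) (vertex J τ) (τ i) other ⟩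
      e R (τ i) * vertex J τ (τ i)  ≈⟨ *-congˡ (trans (vertex-on i) (ind-true (i ∈? J) i∈J)) ⟩
      e R (τ i) * 1#                ≈⟨ *-identityʳ _ ⟩
      e R (τ i)                     ∎
      where
      other : ∀ s → s ≢ τ i → e R s * vertex J τ s ≈ 0#
      other s s≢ with s ∈? R | π s Fin.≟ i
      ... | no _    | _ = zeroˡ _
      ... | yes _   | yes πs≡i = trans (*-congˡ (vertex-off λ s≡ → s≢ (≡.trans s≡ (≡.cong τ πs≡i)))) (zeroʳ _)
      ... | yes s∈R | no  πs≢i = trans (*-congˡ (vertex-off λ s≡ → τ∉R (π s) πs≢i (≡.subst (_∈ R) s≡ s∈R))) (zeroʳ _)

    vertex-meeting : ∀ {S i} → i ∈ J → τ i ∈ S → 1# ≤ e S · vertex J τ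
    vertex-meeting {S} {i} i∈J τi∈S = begin
      1#                             ≈⟨ trans (vertex-on i) (ind-true (i ∈? J) i∈J) ⟨
      vertex J τ (τ i)               ≈⟨ e⁅⁆· (τ i) (vertex J τ) ⟨
      e ⁅ τ i ⁆ · vertex J τ         ≤⟨ ·-mono vertex-nonNeg (λ s → ind-≤ (s ∈? ⁅ τ i ⁆) (e-nonNeg S s)
                                          (λ s∈ → ≤-reflexive (sym (e-in (≡.subst (_∈ S) (≡.sym (x∈⁅y⁆⇒x≡y (τ i) s∈)) τi∈S))))) ⟩
      e S · vertex J τ               ∎

  Δ-adapted : ∀ J → Adapted (Δ J E) (λ _ → 0#) (λ i → ind (i ∈? J))
  Δ-adapted J = record
    { lower    = λ R x x∈ → ·-nonNeg (e-nonNeg R) (proj₁ (to (Δ-⇔ J x) x∈))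
    ; attained = λ C →
        let τ  = λ i → proj₁ (avoiding C i)
            πτ = λ i → proj₁ (proj₂ (avoiding C i))
        in  vertex J τ , from (Δ-⇔ J _) (vertex∈Δ πτ) ,
            λ j → vertex-avoiding πτ (λ i → proj₂ (proj₂ (avoiding C i)) j)
    ; level    = λ i x x∈ → proj₂ (to (Δ-⇔ J x) x∈) i
    }

  simplex-adapted : ∀ i → Adapted (Simplex (E i)) (λ _ → 0#) (λ j → ind (j ∈? ⁅ i ⁆))
  simplex-adapted i = adapted-⇔
    (λ x → mk⇔ (from (simplex-Δ i x) ∘ to (Δ-⇔ ⁅ i ⁆ x)) (from (Δ-⇔ ⁅ i ⁆ x) ∘ to (simplex-Δ i x)))
    (Δ-adapted ⁅ i ⁆)

  -- For proper R, the minimum of e_R over the truncation is 1 if S ⊆ R, and 0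
  -- otherwise.  Along a chain, the minimiser is a vertex through a pivot r of S that otherwise
  -- avoids the chain, so that it meets a member R only if S ⊆ R.
  DTr-adapted : ∀ {S J} → Nonempty S → I S ⊆ J →
    Adapted (DTr J E (Ē S)) (λ R → ind (S ⊆? R)) (λ i → ind (i ∈? J))
  DTr-adapted {S} {J} ne IS⊆J = record
    { lower    = λ R x x∈ → let (x≥0 , _) , 1≤ = to (DTr-⇔ IS⊆J x) x∈ in
        ind-≤ (S ⊆? R) (·-nonNeg (e-nonNeg R) x≥0) (λ S⊆R → ≤-trans 1≤ (·-mono x≥0 (λ s →
          ind-≤ (s ∈? S) (e-nonNeg R s) (λ s∈S → ≤-reflexive (sym (e-in (S⊆R s∈S)))))))
    ; attained = attained
    ; level    = λ i x x∈ → proj₂ (proj₁ (to (DTr-⇔ IS⊆J x) x∈)) i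
    }
    where
    attained : ∀ (C : Chain Proper) → ∃ λ y → DTr J E (Ē S) y ×
               ∀ j → e (Chain.set C j) · y ≈ ind (S ⊆? Chain.set C j)
    attained C with pivot (Chain.set C) (proj₁ ∘ Chain.increasing C) ne
    ... | r , r∈S , minimal =
      vertex J τ , from (DTr-⇔ IS⊆J _) (vertex∈Δ πτ , vertex-meeting πτ πr∈J τπr∈S) ,
      λ j → trans (vertex-avoiding-except πτ πr∈J (τ∉ j))
        (ind-cong (τ (π r) ∈? Chain.set C j) (S ⊆? Chain.set C j)
          (λ τ∈ → minimal j (≡.subst (_∈ Chain.set C j) τπr≡r τ∈)) (λ S⊆ → S⊆ τπr∈S))
      where
      τ : Fin n → Fin m
      τ i with i Fin.≟ π r
      ... | yes _ = r
      ... | no  _ = proj₁ (avoiding C i)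
      πτ : ∀ i → π (τ i) ≡ i
      πτ i with i Fin.≟ π r
      ... | yes i≡ = ≡.sym i≡
      ... | no  _  = proj₁ (proj₂ (avoiding C i))
      τ∉ : ∀ j i → i ≢ π r → τ i ∉ Chain.set C j
      τ∉ j i i≢ with i Fin.≟ π r
      ... | yes i≡ = contradiction i≡ i≢
      ... | no  _  = proj₂ (proj₂ (avoiding C i)) j
      τπr≡r : τ (π r) ≡ r
      τπr≡r with π r Fin.≟ π r
      ... | yes _ = ≡.refl
      ... | no ≢  = contradiction ≡.refl ≢
      πr∈J : π r ∈ J
      πr∈J = IS⊆J (∈I⁺ r∈S)
      τπr∈S : τ (π r) ∈ S
      τπr∈S = ≡.subst (_∈ S) (≡.sym τπr≡r) r∈S

  -- Polyhedra and polytopes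

  -- An intersection of finitely many closed half-spaces, not necessarily bounded.
  IsPolyhedron : ∀ {p} → Pred V p → Set _
  IsPolyhedron Q = ∃ λ k → ∃₂ λ (A : Fin k → V) (b : Fin k → Carrier) →
    ∀ x → Q x ⇔ (∀ i → b i ≤ A i · x)

  polyhedron-⇔ : ∀ {p q} {Q : Pred V p} {Q′ : Pred V q} →
                 (∀ x → Q x ⇔ Q′ x) → IsPolyhedron Q → IsPolyhedron Q′
  polyhedron-⇔ Q⇔Q′ (k , A , b , Q⇔) =
    k , A , b , λ x → mk⇔ (to (Q⇔ x) ∘ from (Q⇔Q′ x)) (to (Q⇔Q′ x) ∘ from (Q⇔ x))

  half-spaces : ∀ {k} (A : Fin k → V) (b : Fin k → Carrier) →
                IsPolyhedron (λ x → ∀ i → b i ≤ A i · x)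
  half-spaces A b = _ , A , b , λ x → mk⇔ (λ p → p) (λ p → p)

  polyhedron-∩ : ∀ {p q} {Q : Pred V p} {Q′ : Pred V q} →
                 IsPolyhedron Q → IsPolyhedron Q′ → IsPolyhedron (λ x → Q x × Q′ x)
  polyhedron-∩ (k , A , b , Q⇔) (k′ , A′ , b′ , Q′⇔) =
    k ℕ.+ k′ , (λ i → [ A , A′ ]′ (Fin.splitAt k i)) , (λ i → [ b , b′ ]′ (Fin.splitAt k i)) ,
    λ x → mk⇔
      (λ (Qx , Q′x) i → both x (to (Q⇔ x) Qx) (to (Q′⇔ x) Q′x) (Fin.splitAt k i))
      (λ p → from (Q⇔ x) (λ i → ≡.subst (bound x) (Fin.splitAt-↑ˡ k i k′) (p (i Fin.↑ˡ k′))) ,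
             from (Q′⇔ x) (λ i → ≡.subst (bound x) (Fin.splitAt-↑ʳ k k′ i) (p (k Fin.↑ʳ i))))
    where
    bound : ∀ x → _ → Set _
    bound x i = [ b , b′ ]′ i ≤ [ A , A′ ]′ i · x
    both : ∀ x → (∀ i → b i ≤ A i · x) → (∀ i → b′ i ≤ A′ i · x) → ∀ i → bound x i
    both x p q (inj₁ i) = p i
    both x p q (inj₂ i) = q i

  polyhedron-translate : ∀ {Q} v → IsPolyhedron Q → IsPolyhedron (translate Q v)
  polyhedron-translate v (k , A , b , Q⇔) = k , A , (λ i → b i - A i · v) , λ x → mk⇔
    (λ Qx i → ≤-resp refl (trans (+-congʳ (·-+ (A i) x v)) (drop (A i · x) (A i · v)))
      (+-monoˡ-≤ (- (A i · v)) (to (Q⇔ _) Qx i)))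
    (λ p → from (Q⇔ _) (λ i → ≤-resp (add (b i) (A i · v)) (sym (·-+ (A i) x v))
      (+-monoˡ-≤ (A i · v) (p i))))
    where
    drop : ∀ x y → x + y - y ≈ x
    drop = solve 2 (λ x y → x :+ y :- y := x) refl
    add : ∀ x y → x - y + y ≈ x
    add = solve 2 (λ x y → x :- y :+ y := x) refl

  InΔ-polyhedron : ∀ J → IsPolyhedron (InΔ J)
  InΔ-polyhedron J = polyhedron-⇔ same (polyhedron-∩ (half-spaces (λ s → e ⁅ s ⁆) (λ _ → 0#))
    (polyhedron-∩ (half-spaces (λ i → e (E i)) (λ i → ind (i ∈? J)))
                  (half-spaces (λ i s → - e (E i) s) (λ i → - ind (i ∈? J)))))
    where
    ·-negˡ : ∀ i x → (λ s → - e (E i) s) · x ≈ - (e (E i) · x)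
    ·-negˡ i x = trans (·-comm _ x) (trans (·-neg x (e (E i))) (-‿cong (·-comm x (e (E i)))))
    involutive : ∀ x → - - x ≈ x
    involutive = solve 1 (λ x → :- :- x := x) refl
    same : ∀ x → ((∀ s → 0# ≤ e ⁅ s ⁆ · x) × (∀ i → ind (i ∈? J) ≤ e (E i) · x) ×
                  (∀ i → - ind (i ∈? J) ≤ (λ s → - e (E i) s) · x)) ⇔ InΔ J x
    same x = mk⇔
      (λ (nonNeg , above , below) → (λ s → ≤-resp refl (e⁅⁆· s x) (nonNeg s)) , λ i → ≤-antisym
        (≤-resp (trans (-‿cong (·-negˡ i x)) (involutive _)) (involutive _) (neg-anti-≤ (below i)))
        (above i))
      (λ (nonNeg , level) → (λ s → ≤-resp refl (sym (e⁅⁆· s x)) (nonNeg s)) ,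
        (λ i → ≤-reflexive (sym (level i))) ,
        (λ i → ≤-resp refl (sym (·-negˡ i x)) (neg-anti-≤ (≤-reflexive (level i)))))

  InΔ-≤1 : ∀ {J x} → InΔ J x → ∀ s → x s ≤ 1#
  InΔ-≤1 {J} {x} (x≥0 , level) s = begin
    x s             ≈⟨ e⁅⁆· s x ⟨
    e ⁅ s ⁆ · x     ≤⟨ ·-mono x≥0 (λ t → ind-≤ (t ∈? ⁅ s ⁆) (e-nonNeg (E (π s)) t)
                         (λ t∈ → ≤-reflexive (sym (e-in (∈E⁺ (≡.cong π (x∈⁅y⁆⇒x≡y s t∈))))))) ⟩
    e (E (π s)) · x ≈⟨ level (π s) ⟩
    ind (π s ∈? J)  ≤⟨ ind-≤1 (π s ∈? J) ⟩
    1#              ∎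

  translate-polytope : ∀ {Q J} S → (∀ x → Q x → InΔ J x) → IsPolyhedron Q →
                       IsPolytope (translate Q (e S))
  translate-polytope {Q} {J} S Q⊆ polyhedron = polyhedron-translate {Q} (e S) polyhedron , 1# , λ x Qx s →
    let x+e∈@(x+e≥0 , _) = Q⊆ _ Qx in
    ≤-resp (+-identityˡ _) (drop (x s) (e S s))
      (+-mono-≤ (x+e≥0 s) (neg-anti-≤ (ind-≤1 (s ∈? S)))) ,
    ≤-trans (≤-resp (+-identityʳ _) refl (+-monoʳ-≤ (x s) (e-nonNeg S s))) (InΔ-≤1 {J} x+e∈ s)
    where
    drop : ∀ x y → x + y - y ≈ x
    drop = solve 2 (λ x y → x :+ y :- y := x) refl

  simplex-polyhedron : ∀ i → IsPolyhedron (Simplex (E i))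
  simplex-polyhedron i = polyhedron-⇔ (λ x → ⇔-sym (simplex-Δ i x)) (InΔ-polyhedron ⁅ i ⁆)

  DTr-polyhedron : ∀ {S J} → I S ⊆ J → IsPolyhedron (DTr J E (Ē S))
  DTr-polyhedron {S} {J} IS⊆J = polyhedron-⇔ (λ x → ⇔-sym (DTr-⇔ IS⊆J x))
    (polyhedron-∩ (InΔ-polyhedron J)
      (polyhedron-⇔ (λ x → mk⇔ (λ p → p Fin.zero) (λ p _ → p))
        (half-spaces {1} (λ _ → e S) (λ _ → 1#))))

  -- Functions given by values on the rays

  fromRays-cong : ∀ {φ ψ} → (∀ R → φ R ≈ ψ R) → ∀ p → fromRays φ p ≈ fromRays ψ p
  fromRays-cong φ≈ψ p = sum-cong {Chain.length (chain p)} (λ j → *-congˡ (φ≈ψ _))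

  fromRays-ray : ∀ φ R ne col → fromRays φ (ray R ne col) ≈ φ R
  fromRays-ray φ R ne col = trans (+-identityʳ _) (*-identityˡ _)

  fromRays-sub : ∀ φ ψ p → fromRays φ p - fromRays ψ p ≈ fromRays (λ R → φ R - ψ R) p
  fromRays-sub φ ψ p = trans (sym (sum-sub {l} _ _))
    (sum-cong {l} (λ j → solve 3 (λ a x y → a :* x :- a :* y := a :* (x :- y)) refl _ _ _))
    where l = Chain.length (chain p)

  fromRays-neg : ∀ φ p → - fromRays φ p ≈ fromRays (λ R → - φ R) p
  fromRays-neg φ p = trans (sym (sum-neg {l} _))
    (sum-cong {l} (λ j → solve 2 (λ a x → :- (a :* x) := a :* :- x) refl _ _))
    where l = Chain.length (chain p)

  fromRays-lincomb : ∀ {k} (c : Fin k → Carrier) (φ : Fin k → Subset m → Carrier) p →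
    sum (λ i → c i * fromRays (φ i) p) ≈ fromRays (λ R → sum (λ i → c i * φ i R)) p
  fromRays-lincomb {k} c φ p = begin-equality
    sum (λ i → c i * fromRays (φ i) p)
      ≈⟨ sum-cong {k} (λ i → *-congˡ (sum-cong {l} (λ j → *-comm _ _))) ⟩
    sum (λ i → c i * sum (λ j → φ i (Chain.set (chain p) j) * coef p j))
      ≈⟨ sum-*-comm {k} {l} c (λ i j → φ i (Chain.set (chain p) j)) (coef p) ⟨
    sum (λ j → sum (λ i → c i * φ i (Chain.set (chain p) j)) * coef p j)
      ≈⟨ sum-cong {l} (λ j → *-comm _ _) ⟩
    fromRays (λ R → sum (λ i → c i * φ i R)) p ∎
    where l = Chain.length (chain p)

  fromRays-linear : ∀ (b : V) p → fromRays (λ R → e R · b) p ≈ b · point p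
  fromRays-linear b p = trans (sym (combination-· (chain p) (coef p) b)) (·-comm (point p) b)

  -- Functions whose values on the rays differ by those of a linear functional
  -- vanishing on L(E) have the same class.
  ∼-fromRays : ∀ {g h φ ψ} (b : V) → (∀ i → e (E i) · b ≈ 0#) →
    (∀ p → g p ≈ fromRays φ p) → (∀ p → h p ≈ fromRays ψ p) →
    (∀ R → φ R - ψ R ≈ e R · b) → g ∼ h
  ∼-fromRays {g} {h} {φ} {ψ} b b⊥L g≈ h≈ φ-ψ = b , (λ i → trans (·-comm b (e (E i))) (b⊥L i)) , λ p → begin-equality
    g p - h p                      ≈⟨ +-cong (g≈ p) (-‿cong (h≈ p)) ⟩
    fromRays φ p - fromRays ψ p    ≈⟨ fromRays-sub φ ψ p ⟩
    fromRays (λ R → φ R - ψ R) p   ≈⟨ fromRays-cong φ-ψ p ⟩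
    fromRays (λ R → e R · b) p     ≈⟨ fromRays-linear b p ⟩
    b · point p                    ∎

  -- The element of each colour i whose coordinate represents α i.
  σ : Fin n → Fin m
  σ i = proj₁ (π-surjective i)

  πσ : ∀ i → π (σ i) ≡ i
  πσ i = proj₂ (π-surjective i) ≡.refl

  e·e⁅⁆ : ∀ R s → e R · e ⁅ s ⁆ ≈ e R s
  e·e⁅⁆ R s = trans (·-comm (e R) (e ⁅ s ⁆)) (e⁅⁆· s (e R))

  e·vertex : ∀ R J → e R · vertex J σ ≈ sum (λ i → ind (i ∈? J) * e R (σ i))
  e·vertex R J = begin-equality
    e R · vertex J σ
      ≈⟨ ·-comm (e R) (vertex J σ) ⟩
    vertex J σ · e R
      ≈⟨ ·-cong {y = e R} expand (λ _ → refl) ⟩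
    (λ s → sum (λ i → ind (i ∈? J) * e ⁅ σ i ⁆ s)) · e R
      ≈⟨ sum-*-comm {n} {m} (λ i → ind (i ∈? J)) (λ i → e ⁅ σ i ⁆) (e R) ⟩
    sum (λ i → ind (i ∈? J) * (e ⁅ σ i ⁆ · e R))
      ≈⟨ sum-cong {n} (λ i → *-congˡ (e⁅⁆· (σ i) (e R))) ⟩
    sum (λ i → ind (i ∈? J) * e R (σ i)) ∎
    where
    expand : ∀ s → vertex J σ s ≈ sum (λ i → ind (i ∈? J) * e ⁅ σ i ⁆ s)
    expand s = sym (trans
      (sum-single {n} _ (π s) (λ i i≢ → trans (*-congˡ (e-out (λ s∈ →
        i≢ (≡.trans (≡.sym (πσ i)) (≡.cong π (≡.sym (x∈⁅y⁆⇒x≡y (σ i) s∈))))))) (zeroʳ _)))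
      (*-congˡ (ind-cong (s ∈? ⁅ σ (π s) ⁆) (s Fin.≟ σ (π s))
        (x∈⁅y⁆⇒x≡y _) (λ s≡ → ≡.subst (_∈ ⁅ σ (π s) ⁆) (≡.sym s≡) (x∈⁅x⁆ _)))))

  E·e-colored : ∀ {S} → IsColored S → ∀ i → e (E i) · e S ≈ ind (i ∈? I S)
  E·e-colored {S} col i with i ∈? I S
  ... | no i∉ = sum-0 {m} term
    where
    term : ∀ s → e (E i) s * e S s ≈ 0#
    term s with s ∈? S
    ... | no  _   = zeroʳ _
    ... | yes s∈S = trans (*-congʳ (e-out (λ s∈E → i∉ (≡.subst (_∈ I S) (∈E⁻ s∈E) (∈I⁺ s∈S))))) (zeroˡ _)
  ... | yes i∈ = let s , s∈S , πs≡i = ∈I⁻ {S} i∈ in trans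
    (·-single (e (E i)) (e S) s (other s s∈S πs≡i))
    (trans (*-cong (e-in (∈E⁺ πs≡i)) (e-in s∈S)) (*-identityˡ _))
    where
    other : ∀ s → s ∈ S → π s ≡ i → ∀ t → t ≢ s → e (E i) t * e S t ≈ 0#
    other s s∈S πs≡i t t≢s with t ∈? S | t ∈? E i
    ... | no _    | _ = zeroʳ _
    ... | yes _   | no _ = zeroˡ _
    ... | yes t∈S | yes t∈E = contradiction
      (colored-unique {S} col t∈S s∈S (≡.trans (∈E⁻ t∈E) (≡.sym πs≡i))) t≢s

  -- The values of β S on the rays.
  βRays : Subset m → Subset m → Carrier
  βRays S R = e R · vertex (I S) σ - ind (S ⊆? R)

  β-fromRays : ∀ S p → β S p ≈ fromRays (βRays S) p
  β-fromRays S p = begin-equality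
    ∑∈ (I S) (λ i → α i p) - f S p
      ≈⟨ +-congʳ (∑∈-ind (I S) (λ i → α i p)) ⟩
    sum (λ i → ind (i ∈? I S) * α i p) - f S p
      ≈⟨ +-congʳ (fromRays-lincomb {n} (λ i → ind (i ∈? I S)) (λ i R → ind (σ i ∈? R)) p) ⟩
    fromRays αRays p - fromRays fRays p
      ≈⟨ fromRays-sub αRays fRays p ⟩
    fromRays (λ R → αRays R - fRays R) p
      ≈⟨ fromRays-cong {βRays S} (λ R → +-congʳ (e·vertex R (I S))) p ⟨
    fromRays (βRays S) p ∎
    where
    αRays fRays : Subset m → Carrier
    αRays R = sum (λ i → ind (i ∈? I S) * e R (σ i))
    fRays R = ind (S ⊆? R)

  -- Support functions

  IsMin-resp : ∀ {Q u μ ν} → μ ≈ ν → IsMin Q u μ → IsMin Q u ν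
  IsMin-resp μ≈ν ((x , Qx , ux≈) , min) =
    (x , Qx , trans ux≈ μ≈ν) , λ y Qy → ≤-resp μ≈ν refl (min y Qy)

  IsMin-negate : ∀ {Q u μ} → Extensional Q → IsMin Q u μ → IsMax (negate Q) u (- μ)
  IsMin-negate {Q} {u} ext ((x , Qx , ux≈) , min) =
    ((λ s → - x s) , ext (λ s → solve 1 (λ a → a := :- :- a) refl (x s)) Qx ,
       trans (·-neg u x) (-‿cong ux≈)) ,
    λ y Qy → ≤-resp (trans (-‿cong (·-neg u y)) (solve 1 (λ a → :- :- a := a) refl (u · y))) refl
      (neg-anti-≤ (min _ Qy))

  IsMax-⇔ : ∀ {Q Q′ u μ} → (∀ x → Q x ⇔ Q′ x) → IsMax Q u μ → IsMax Q′ u μ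
  IsMax-⇔ Q⇔Q′ ((x , Qx , ux≈) , max) =
    (x , to (Q⇔Q′ x) Qx , ux≈) , λ y Q′y → max y (from (Q⇔Q′ y) Q′y)

  IsMax-unique : ∀ {Q u μ ν} → IsMax Q u μ → IsMax Q u ν → μ ≈ ν
  IsMax-unique ((x , Qx , ux≈) , max) ((y , Qy , uy≈) , max′) =
    ≤-antisym (≤-resp ux≈ refl (max′ x Qx)) (≤-resp uy≈ refl (max y Qy))

  class-⇔ : ∀ {Q Q′ h} → (∀ x → Q x ⇔ Q′ x) → MaxRestrictsToClass Q h → MaxRestrictsToClass Q′ h
  class-⇔ {Q} Q⇔Q′ (g , max , g∼h) = g , (λ p u u≡ → IsMax-⇔ {Q} Q⇔Q′ (max p u u≡)) , g∼h

  -- A function whose class contains the restriction of a support function does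
  -- not depend on the cone and the representative modulo L(E) chosen for a point.
  class-well-defined : ∀ {Q h} → MaxRestrictsToClass Q h → ∀ p q → point p ≡L point q → h p ≈ h q
  class-well-defined {Q} {h} (g , max , b , b⊥L , g-h≈) p q p≡q = begin-equality
    h p                    ≈⟨ rewrite-h p ⟩
    g p - b · point p      ≈⟨ +-cong (IsMax-unique {Q} (max p (point p) ≡L-refl) (max q (point p) p≡q))
                                (-‿cong b·) ⟩
    g q - b · point q      ≈⟨ rewrite-h q ⟨
    h q                    ∎
    where
    rewrite-h : ∀ p → h p ≈ g p - b · point p
    rewrite-h p = trans (solve 2 (λ x y → x := y :- (y :- x)) refl (h p) (g p)) (+-congˡ (-‿cong (g-h≈ p)))
    b· : b · point p ≈ b · point q
    b· = begin-equality
      b · point p   ≈⟨ ·-comm b (point p) ⟩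
      point p · b   ≈⟨ L-· p≡q b ⟩
      point q · b + sum (λ i → proj₁ p≡q i * (e (E i) · b))
        ≈⟨ +-congˡ (sum-0 {n} (λ i → trans (*-congˡ (trans (·-comm (e (E i)) b) (b⊥L i))) (zeroʳ _))) ⟩
      point q · b + 0#   ≈⟨ +-identityʳ _ ⟩
      point q · b   ≈⟨ ·-comm (point q) b ⟩
      b · point q   ∎

  -- Sums over all subsets and Möbius inversion

  ∑⊆-cong : ∀ {k} {g h : Subset k → Carrier} → (∀ S → g S ≈ h S) → ∑⊆ g ≈ ∑⊆ h
  ∑⊆-cong {ℕ.zero}  g≈h = g≈h []
  ∑⊆-cong {ℕ.suc k} g≈h = +-cong (∑⊆-cong {k} (λ S → g≈h (outside ∷ S))) (∑⊆-cong {k} (λ S → g≈h (inside ∷ S)))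

  ∑⊆-0 : ∀ {k} {g : Subset k → Carrier} → (∀ S → g S ≈ 0#) → ∑⊆ g ≈ 0#
  ∑⊆-0 {ℕ.zero}  g≈0 = g≈0 []
  ∑⊆-0 {ℕ.suc k} g≈0 = trans
    (+-cong (∑⊆-0 {k} (λ S → g≈0 (outside ∷ S))) (∑⊆-0 {k} (λ S → g≈0 (inside ∷ S)))) (+-identityˡ _)

  ∑⊆-+ : ∀ {k} (g h : Subset k → Carrier) → ∑⊆ (λ S → g S + h S) ≈ ∑⊆ g + ∑⊆ h
  ∑⊆-+ {ℕ.zero}  g h = refl
  ∑⊆-+ {ℕ.suc k} g h = trans
    (+-cong (∑⊆-+ {k} (λ S → g (outside ∷ S)) (λ S → h (outside ∷ S)))
            (∑⊆-+ {k} (λ S → g (inside ∷ S)) (λ S → h (inside ∷ S))))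
    (solve 4 (λ a b c d → a :+ b :+ (c :+ d) := a :+ c :+ (b :+ d)) refl _ _ _ _)

  ∑⊆-neg : ∀ {k} (g : Subset k → Carrier) → ∑⊆ (λ S → - g S) ≈ - ∑⊆ g
  ∑⊆-neg {ℕ.zero}  g = refl
  ∑⊆-neg {ℕ.suc k} g = trans
    (+-cong (∑⊆-neg {k} (λ S → g (outside ∷ S))) (∑⊆-neg {k} (λ S → g (inside ∷ S))))
    (solve 2 (λ a b → :- a :+ :- b := :- (a :+ b)) refl _ _)

  ∑⊆-sub : ∀ {k} (g h : Subset k → Carrier) → ∑⊆ (λ S → g S - h S) ≈ ∑⊆ g - ∑⊆ h
  ∑⊆-sub g h = trans (∑⊆-+ g (λ S → - h S)) (+-congˡ (∑⊆-neg h))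

  ∑⊆-sum : ∀ {k l} (g : Subset k → Fin l → Carrier) →
           ∑⊆ (λ S → sum (g S)) ≈ sum (λ i → ∑⊆ (λ S → g S i))
  ∑⊆-sum {ℕ.zero}      g = refl
  ∑⊆-sum {ℕ.suc k} {l} g = trans
    (+-cong (∑⊆-sum {k} {l} (λ S → g (outside ∷ S))) (∑⊆-sum {k} {l} (λ S → g (inside ∷ S))))
    (sym (∑-distrib-+ {l} _ _))

  ∑⊆-*ʳ : ∀ {k} (g : Subset k → Carrier) x → ∑⊆ (λ S → g S * x) ≈ ∑⊆ g * x
  ∑⊆-*ʳ {ℕ.zero}  g x = refl
  ∑⊆-*ʳ {ℕ.suc k} g x = trans
    (+-cong (∑⊆-*ʳ {k} (λ S → g (outside ∷ S)) x) (∑⊆-*ʳ {k} (λ S → g (inside ∷ S)) x))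
    (sym (distribʳ x _ _))

  -- Exchange of a weighted sum over subsets and a weighted finite sum.
  ∑⊆-exchange : ∀ {k l} (d : Subset k → Carrier) (h : Subset k → Fin l → Carrier) (x : Fin l → Carrier) →
    ∑⊆ (λ S → d S * sum (λ i → h S i * x i)) ≈ sum (λ i → ∑⊆ (λ S → d S * h S i) * x i)
  ∑⊆-exchange {k} {l} d h x = begin-equality
    ∑⊆ (λ S → d S * sum (λ i → h S i * x i))
      ≈⟨ ∑⊆-cong {k} (λ S → trans (*-distribˡ-sum {l} (d S) (λ i → h S i * x i))
           (sum-cong {l} (λ i → sym (*-assoc _ _ _)))) ⟩
    ∑⊆ (λ S → sum (λ i → d S * h S i * x i))
      ≈⟨ ∑⊆-sum {k} {l} (λ S i → d S * h S i * x i) ⟩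
    sum (λ i → ∑⊆ (λ S → d S * h S i * x i))
      ≈⟨ sum-cong {l} (λ i → ∑⊆-*ʳ (λ S → d S * h S i) (x i)) ⟩
    sum (λ i → ∑⊆ (λ S → d S * h S i) * x i) ∎

  ·-∑⊆ : ∀ {k} (u : V) (d : Subset k → Carrier) (w : Subset k → V) →
    u · (λ s → ∑⊆ (λ S → d S * w S s)) ≈ ∑⊆ (λ S → d S * (u · w S))
  ·-∑⊆ {k} u d w = trans (·-comm u _) (trans (sym (∑⊆-exchange d w u))
    (∑⊆-cong {k} (λ S → *-congˡ (·-comm (w S) u))))

  fromRays-∑⊆ : ∀ {k} (d : Subset k → Carrier) (φ : Subset k → Subset m → Carrier) p →
    ∑⊆ (λ S → d S * fromRays (φ S) p) ≈ fromRays (λ R → ∑⊆ (λ S → d S * φ S R)) p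
  fromRays-∑⊆ {k} d φ p = begin-equality
    ∑⊆ (λ S → d S * fromRays (φ S) p)
      ≈⟨ ∑⊆-cong {k} (λ S → *-congˡ {x = d S} (sum-cong {l} (λ j → *-comm (coef p j) (φ S (Chain.set (chain p) j))))) ⟩
    ∑⊆ (λ S → d S * sum (λ j → φ S (Chain.set (chain p) j) * coef p j))
      ≈⟨ ∑⊆-exchange {l = l} d (λ S j → φ S (Chain.set (chain p) j)) (coef p) ⟩
    sum (λ j → ∑⊆ (λ S → d S * φ S (Chain.set (chain p) j)) * coef p j)
      ≈⟨ sum-cong {l} (λ j → *-comm (∑⊆ (λ S → d S * φ S (Chain.set (chain p) j))) (coef p j)) ⟩
    fromRays (λ R → ∑⊆ (λ S → d S * φ S R)) p ∎
    where l = Chain.length (chain p)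

  -- The sum of d over the subsets of R.
  zeta : ∀ {k} → (Subset k → Carrier) → Subset k → Carrier
  zeta d R = ∑⊆ λ S → d S * ind (S ⊆? R)

  zeta-outside : ∀ {k} (d : Subset (ℕ.suc k) → Carrier) R →
                 zeta d (outside ∷ R) ≈ zeta (λ S → d (outside ∷ S)) R
  zeta-outside {k} d R = trans (+-congˡ (∑⊆-0 {k} (λ S → zeroʳ _))) (+-identityʳ _)

  -- The recursion computes the Möbius coefficients of φ one element at a time.
  zeta-surjective : ∀ {k} (φ : Subset k → Carrier) → ∃ λ d → ∀ R → zeta d R ≈ φ R
  zeta-surjective {ℕ.zero}  φ = φ , λ { [] → *-identityʳ _ }
  zeta-surjective {ℕ.suc k} φ with zeta-surjective {k} (λ R → φ (outside ∷ R))
                                 | zeta-surjective {k} (λ R → φ (inside ∷ R) - φ (outside ∷ R))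
  ... | d₀ , zeta-d₀ | d₁ , zeta-d₁ = d , zeta-d
    where
    d : Subset (ℕ.suc k) → Carrier
    d (outside ∷ S) = d₀ S
    d (inside  ∷ S) = d₁ S
    zeta-d : ∀ R → zeta d R ≈ φ R
    zeta-d (outside ∷ R) = trans (zeta-outside d R) (zeta-d₀ R)
    zeta-d (inside  ∷ R) = trans (+-cong (zeta-d₀ R) (zeta-d₁ R))
      (solve 2 (λ x y → x :+ (y :- x) := y) refl (φ (outside ∷ R)) (φ (inside ∷ R)))

  -- Möbius inversion on a downward closed family of subsets.
  zeta-injective : ∀ {k p} {P : Pred (Subset k) p} → (∀ {S R} → S ⊆ R → P R → P S) →
    ∀ d → (∀ R → P R → zeta d R ≈ 0#) → ∀ S → P S → d S ≈ 0#
  zeta-injective {ℕ.zero} down d zeta≈0 [] P[] = trans (sym (*-identityʳ _)) (zeta≈0 [] P[])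
  zeta-injective {ℕ.suc k} {P = P} down d zeta≈0 = λ where
      (outside ∷ S) PS → zeta-injective {k} {P = λ R → P (outside ∷ R)} (λ S⊆R → down (out⊆ S⊆R)) _
        zeta-out≈0 S PS
      (inside  ∷ S) PS → zeta-injective {k} {P = λ R → P (inside ∷ R)} (λ S⊆R → down (s⊆s S⊆R)) _
        (λ R PR → begin-equality
          zeta (λ S → d (inside ∷ S)) R
            ≈⟨ +-identityˡ _ ⟨
          0# + zeta (λ S → d (inside ∷ S)) R
            ≈⟨ +-congʳ (zeta-out≈0 R (down (out⊆ (λ x∈ → x∈)) PR)) ⟨
          zeta d (inside ∷ R)
            ≈⟨ zeta≈0 (inside ∷ R) PR ⟩
          0# ∎) S PS
    where
    zeta-out≈0 : ∀ R → P (outside ∷ R) → zeta (λ S → d (outside ∷ S)) R ≈ 0#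
    zeta-out≈0 R PR = trans (sym (zeta-outside d R)) (zeta≈0 (outside ∷ R) PR)

  -- Globally linear functions

  -- Restrictions of linear functionals vanishing on L(E).
  IsLinear : FanFunction → Set _
  IsLinear h = ∃ λ (b : V) → (∀ i → b · e (E i) ≈ 0#) × (∀ p → h p ≈ b · point p)

  linear-0 : ∀ {h} → (∀ p → h p ≈ 0#) → IsLinear h
  linear-0 h≈0 = (λ _ → 0#) , (λ i → zero· (e (E i))) , λ p → trans (h≈0 p) (sym (zero· (point p)))
    where
    zero· : ∀ (x : V) → (λ _ → 0#) · x ≈ 0#
    zero· x = sum-0 {m} (λ s → zeroˡ _)

  linear-+ : ∀ {g h} → IsLinear g → IsLinear h → IsLinear (λ p → g p + h p)
  linear-+ (b , b⊥L , g≈) (b′ , b′⊥L , h≈) = (λ s → b s + b′ s) ,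
    (λ i → trans (·-+ˡ (e (E i))) (trans (+-cong (b⊥L i) (b′⊥L i)) (+-identityˡ _))) ,
    λ p → trans (+-cong (g≈ p) (h≈ p)) (sym (·-+ˡ (point p)))
    where
    ·-+ˡ : ∀ (x : V) → (λ s → b s + b′ s) · x ≈ b · x + b′ · x
    ·-+ˡ x = trans (·-comm _ x) (trans (·-+ x b b′) (+-cong (·-comm x b) (·-comm x b′)))

  linear-* : ∀ {h} x → IsLinear h → IsLinear (λ p → x * h p)
  linear-* x (b , b⊥L , h≈) = (λ s → x * b s) ,
    (λ i → trans (·-*ˡ (e (E i))) (trans (*-congˡ (b⊥L i)) (zeroʳ x))) ,
    λ p → trans (*-congˡ (h≈ p)) (sym (·-*ˡ (point p)))
    where
    ·-*ˡ : ∀ (y : V) → (λ s → x * b s) · y ≈ x * (b · y)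
    ·-*ˡ y = trans (sum-cong {m} (λ s → *-assoc x (b s) (y s))) (sym (*-distribˡ-sum {m} x (λ s → b s * y s)))

  linear-∑⊆ : ∀ {k} {h : Subset k → FanFunction} → (∀ S → IsLinear (h S)) → IsLinear (λ p → ∑⊆ (λ S → h S p))
  linear-∑⊆ {ℕ.zero}  linear = linear []
  linear-∑⊆ {ℕ.suc k} {h} linear = linear-+
    {λ p → ∑⊆ (λ S → h (outside ∷ S) p)} {λ p → ∑⊆ (λ S → h (inside ∷ S) p)}
    (linear-∑⊆ {k} {λ S → h (outside ∷ S)} (λ S → linear (outside ∷ S)))
    (linear-∑⊆ {k} {λ S → h (inside ∷ S)} (λ S → linear (inside ∷ S)))

  -- For a singleton S, consisting of s, the function f S equals ℓ s, whose class
  -- is that of the colour of s, so β S is globally linear.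
  β-singleton : ∀ {S} → Nonempty S → IsColored S → ∣ S ∣ ℕ.≤ 1 → IsLinear (β S)
  β-singleton {S} (r , r∈S) col ∣S∣≤1 = b ,
    (λ i → trans (·-comm b (e (E i))) (trans (·-sub (e (E i)) (vertex (I S) σ) (e S))
      (x≈y⇒x-y≈0 (trans (proj₂ (vertex∈Δ πσ) i) (sym (E·e-colored col i)))))) ,
    λ p → trans (β-fromRays S p) (trans (fromRays-cong {βRays S} {λ R → e R · b} value p) (fromRays-linear b p))
    where
    b : V
    b s = vertex (I S) σ s - e S s
    e·e : ∀ R → e R · e S ≈ ind (S ⊆? R)
    e·e R = begin-equality
      e R · e S     ≈⟨ ·-single (e R) (e S) r (λ s s≢r → trans
                         (*-congˡ (e-out (λ s∈S → s≢r (∣p∣≤1⇒unique ∣S∣≤1 s∈S r∈S)))) (zeroʳ _)) ⟩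
      e R r * e S r ≈⟨ trans (*-congˡ (e-in r∈S)) (*-identityʳ _) ⟩
      e R r         ≈⟨ ind-cong (r ∈? R) (S ⊆? R)
                         (λ r∈R {s} s∈S → ≡.subst (_∈ R) (∣p∣≤1⇒unique ∣S∣≤1 r∈S s∈S) r∈R) (λ S⊆R → S⊆R r∈S) ⟩
      ind (S ⊆? R)  ∎
    value : ∀ R → βRays S R ≈ e R · b
    value R = trans (+-congˡ (-‿cong (sym (e·e R)))) (sym (·-sub (e R) (vertex (I S) σ) (e S)))

  fromRays-linear-on-cones : ∀ {h : FanFunction} {φ} → (∀ p → h p ≈ fromRays φ p) → ∀ p → let open Chain (chain p) in
    h p ≈ sum (λ j → coef p j * h (ray (set j) (proj₁ (member j)) (proj₂ (member j))))
  fromRays-linear-on-cones {h} {φ} h≈ p = trans (h≈ p) (sum-cong {length} term)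
    where
    open Chain (chain p)
    term : ∀ j → coef p j * φ (set j) ≈ coef p j * h (ray (set j) (proj₁ (member j)) (proj₂ (member j)))
    term j = *-congˡ (sym (trans (h≈ (ray (set j) (proj₁ (member j)) (proj₂ (member j))))
      (fromRays-ray φ (set j) (proj₁ (member j)) (proj₂ (member j)))))

  -- The basis

  -- The index sets of the classes β S in the basis.
  IsBig : Pred (Subset m) _
  IsBig S = IsColored S × 2 ℕ.≤ ∣ S ∣

  big-nonempty : ∀ {S} → IsBig S → Nonempty S
  big-nonempty (_ , 2≤∣S∣) = 1≤∣p∣⇒nonempty (ℕ.≤-trans (ℕ.s≤s ℕ.z≤n) 2≤∣S∣)

  colored? : ∀ S → Dec (IsColored S)
  colored? S = Fin.all? (λ i → ∣ S ∩ E i ∣ ℕ.≤? 1)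

  big? : ∀ S → Dec (IsBig S)
  big? S = colored? S ×-dec (2 ℕ.≤? ∣ S ∣)

  combination-of : (Fin n → Carrier) → (Subset m → Carrier) → FanFunction
  combination-of b d q = sum (λ i → b i * α i q) + ∑⊆ (λ S → d S * β S q)

  -- Every piecewise linear function is a combination of the α i and β S modulo
  -- globally linear functions.
  module Spanning (g : FanFunction) (g-pl : IsPiecewiseLinear g) where

    -- The values of g on the rays, extended by 0 to the subsets that are empty
    -- or not colored.
    value : ∀ R → Dec (Nonempty R) → Dec (IsColored R) → Carrier
    value R (yes ne) (yes col) = g (ray R ne col)
    value R _        _         = 0#

    values : Subset m → Carrier
    values R = value R (nonempty? R) (colored? R)

    values-ray : ∀ R ne col → values R ≈ g (ray R ne col)
    values-ray R ne col with nonempty? R | colored? R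
    ... | yes ne′ | yes col′ = proj₁ g-pl (ray R ne′ col′) (ray R ne col) ≡L-refl
    ... | no ¬ne  | _        = contradiction ne ¬ne
    ... | yes _   | no ¬col  = contradiction col ¬col

    values-empty : ∀ R → Empty R → values R ≈ 0#
    values-empty R empty with nonempty? R
    ... | yes ne = contradiction ne empty
    ... | no  _  = refl

    d₀ : Subset m → Carrier
    d₀ = proj₁ (zeta-surjective values)

    d₀-empty : ∀ S → Empty S → d₀ S ≈ 0#
    d₀-empty = zeta-injective {P = Empty} (λ S⊆R empty (s , s∈S) → empty (s , S⊆R s∈S)) d₀
      (λ R empty → trans (proj₂ (zeta-surjective values) R) (values-empty R empty))

    -- The Möbius coefficients, restricted to nonempty colored sets.  The sums
    -- over the subsets of a colored set do not change, because these are
    -- colored and the coefficient of the empty set is zero.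
    d : Subset m → Carrier
    d S = ind (nonempty? S ×-dec colored? S) * d₀ S

    zeta-d : ∀ R → IsColored R → zeta d R ≈ values R
    zeta-d R col = trans (∑⊆-cong term) (proj₂ (zeta-surjective values) R)
      where
      term : ∀ S → d S * ind (S ⊆? R) ≈ d₀ S * ind (S ⊆? R)
      term S with S ⊆? R
      ... | no _ = trans (zeroʳ _) (sym (zeroʳ _))
      ... | yes S⊆R = *-congʳ (agree (nonempty? S))
        where
        agree : Dec (Nonempty S) → d S ≈ d₀ S
        agree (yes ne)   = trans (*-congʳ (ind-true (nonempty? S ×-dec colored? S)
          (ne , ⊆-colored {S} {R} S⊆R col))) (*-identityˡ _)
        agree (no empty) = trans (*-congˡ (d₀-empty S empty)) (trans (zeroʳ _) (sym (d₀-empty S empty)))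

    -- The coefficients obtained by substituting f S = αs S - β S, with αs S
    -- the sum of the α i over I S, and discarding the S with one element.
    b : Fin n → Carrier
    b i = ∑⊆ (λ S → d S * ind (i ∈? I S))

    d′ : Subset m → Carrier
    d′ S = ind (big? S) * - d S

    d′-supported : ∀ S → ¬ IsBig S → d′ S ≈ 0#
    d′-supported S ¬big = trans (*-congʳ (ind-false (big? S) ¬big)) (zeroˡ _)

    expansion : ∀ p → g p ≈ ∑⊆ (λ S → d S * f S p)
    expansion p = begin-equality
      g p
        ≈⟨ proj₂ g-pl p ⟩
      sum (λ j → coef p j * g (ray (set j) (proj₁ (member j)) (proj₂ (member j))))
        ≈⟨ sum-cong {length} (λ j → *-congˡ (trans (zeta-d (set j) (proj₂ (member j)))
             (values-ray (set j) (proj₁ (member j)) (proj₂ (member j))))) ⟨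
      fromRays (zeta d) p
        ≈⟨ fromRays-∑⊆ d (λ S R → ind (S ⊆? R)) p ⟨
      ∑⊆ (λ S → d S * f S p) ∎
      where open Chain (chain p)

    αs : Subset m → FanFunction
    αs S p = ∑∈ (I S) (λ i → α i p)

    b-αs : ∀ p → sum (λ i → b i * α i p) ≈ ∑⊆ (λ S → d S * αs S p)
    b-αs p = begin-equality
      sum (λ i → b i * α i p)
        ≈⟨ ∑⊆-exchange {l = n} d (λ S i → ind (i ∈? I S)) (λ i → α i p) ⟨
      ∑⊆ (λ S → d S * sum (λ i → ind (i ∈? I S) * α i p))
        ≈⟨ ∑⊆-cong {m} (λ S → *-congˡ (∑∈-ind (I S) (λ i → α i p))) ⟨
      ∑⊆ (λ S → d S * αs S p) ∎

    -- The discarded terms; they vanish unless S is a singleton.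
    remainder : Subset m → FanFunction
    remainder S p = (- d S - d′ S) * β S p

    big-cancels : ∀ {S} → IsBig S → - d S - d′ S ≈ 0#
    big-cancels {S} big = trans (+-congˡ (-‿cong (trans (*-congʳ (ind-true (big? S) big)) (*-identityˡ _))))
      (-‿inverseʳ (- d S))

    both-vanish : ∀ {S} → ¬ IsBig S → ¬ (Nonempty S × IsColored S) → - d S - d′ S ≈ 0#
    both-vanish {S} ¬big ¬S = trans
      (+-cong (-‿cong (trans (*-congʳ (ind-false (nonempty? S ×-dec colored? S) ¬S)) (zeroˡ _)))
              (-‿cong (d′-supported S ¬big)))
      (solve 0 (:- con (+ 0) :- con (+ 0) := con (+ 0)) refl)

    remainder-linear : ∀ S → IsLinear (remainder S)
    remainder-linear S with big? S | nonempty? S ×-dec colored? S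
    ... | yes big | _ = linear-0 (λ p → trans (*-congʳ (big-cancels big)) (zeroˡ _))
    ... | no ¬big | yes (ne , col) = linear-* {β S} (- d S - d′ S)
      (β-singleton ne col (ℕ.≮⇒≥ (λ 2≤∣S∣ → ¬big (col , 2≤∣S∣))))
    ... | no ¬big | no ¬S = linear-0 (λ p → trans (*-congʳ (both-vanish ¬big ¬S)) (zeroˡ _))
    difference : ∀ p → g p - combination-of b d′ p ≈ ∑⊆ (λ S → remainder S p)
    difference p = begin-equality
      g p - combination-of b d′ p
        ≈⟨ +-cong (expansion p) (-‿cong (+-congʳ (b-αs p))) ⟩
      F - (A + B)
        ≈⟨ solve 3 (λ x y z → x :- (y :+ z) := x :- y :- z) refl F A B ⟩
      F - A - B
        ≈⟨ +-congʳ (∑⊆-sub (λ S → d S * f S p) (λ S → d S * αs S p)) ⟨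
      ∑⊆ (λ S → d S * f S p - d S * αs S p) - B
        ≈⟨ ∑⊆-sub (λ S → d S * f S p - d S * αs S p) (λ S → d′ S * β S p) ⟨
      ∑⊆ (λ S → d S * f S p - d S * αs S p - d′ S * β S p)
        ≈⟨ ∑⊆-cong {m} (λ S → solve 4 (λ x y z w → x :* y :- x :* z :- w :* (z :- y) := (:- x :- w) :* (z :- y))
             refl (d S) (f S p) (αs S p) (d′ S)) ⟩
      ∑⊆ (λ S → remainder S p) ∎
      where
      F = ∑⊆ (λ S → d S * f S p)
      A = ∑⊆ (λ S → d S * αs S p)
      B = ∑⊆ (λ S → d′ S * β S p)

    g∼combination : g ∼ combination-of b d′
    g∼combination = let c , c⊥L , ≈c = linear-∑⊆ {h = remainder} remainder-linear in
      c , c⊥L , λ p → trans (difference p) (≈c p)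

  -- A combination of the α i and β S that is globally linear, given by b′, has
  -- zero coefficients.
  module Independent (b : Fin n → Carrier) (d : Subset m → Carrier)
    (d-supported : ∀ S → ¬ IsBig S → d S ≈ 0#)
    (b′ : V) (b′⊥L : ∀ i → b′ · e (E i) ≈ 0#)
    (combination≈b′ : ∀ p → combination-of b d p - 0# ≈ b′ · point p) where

    -- The part of the relation that is additive in the set R at whose ray it is
    -- evaluated, as a weight on E.
    weight : V
    weight s = sum (λ i → b i * e ⁅ σ i ⁆ s) + ∑⊆ (λ S → d S * vertex (I S) σ s) - b′ s

    ·-weight : ∀ u → u · weight ≈
      sum (λ i → b i * (u · e ⁅ σ i ⁆)) + ∑⊆ (λ S → d S * (u · vertex (I S) σ)) - u · b′
    ·-weight u = begin-equality
      u · weight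
        ≈⟨ ·-sub u (λ s → w₁ s + w₂ s) b′ ⟩
      u · (λ s → w₁ s + w₂ s) - u · b′
        ≈⟨ +-congʳ (·-+ u w₁ w₂) ⟩
      u · w₁ + u · w₂ - u · b′
        ≈⟨ +-congʳ (+-cong
             (trans (·-comm u w₁) (trans (sum-*-comm {n} {m} b (λ i → e ⁅ σ i ⁆) u)
                (sum-cong {n} (λ i → *-congˡ (·-comm (e ⁅ σ i ⁆) u)))))
             (·-∑⊆ u d (λ S → vertex (I S) σ))) ⟩
      sum (λ i → b i * (u · e ⁅ σ i ⁆)) + ∑⊆ (λ S → d S * (u · vertex (I S) σ)) - u · b′ ∎
      where
      w₁ w₂ : V
      w₁ s = sum (λ i → b i * e ⁅ σ i ⁆ s)
      w₂ s = ∑⊆ (λ S → d S * vertex (I S) σ s)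

    -- The relation evaluated at e_R.
    relation : ∀ R → Nonempty R → IsColored R → e R · weight ≈ zeta d R
    relation R ne col = begin-equality
      e R · weight
        ≈⟨ ·-weight (e R) ⟩
      X + Y - e R · b′
        ≈⟨ +-congˡ (-‿cong at-ray) ⟩
      X + Y - (X + (Y - zeta d R))
        ≈⟨ solve 3 (λ x y z → x :+ y :- (x :+ (y :- z)) := z) refl X Y (zeta d R) ⟩
      zeta d R ∎
      where
      r = ray R ne col
      X = sum (λ i → b i * (e R · e ⁅ σ i ⁆))
      Y = ∑⊆ (λ S → d S * (e R · vertex (I S) σ))
      at-ray : e R · b′ ≈ X + (Y - zeta d R)
      at-ray = begin-equality
        e R · b′
          ≈⟨ fromRays-ray (λ R → e R · b′) R ne col ⟨
        fromRays (λ R → e R · b′) r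
          ≈⟨ fromRays-linear b′ r ⟩
        b′ · point r
          ≈⟨ combination≈b′ r ⟨
        combination-of b d r - 0#
          ≈⟨ solve 1 (λ x → x :- con (+ 0) := x) refl (combination-of b d r) ⟩
        combination-of b d r
          ≈⟨ +-cong
               (sum-cong {n} (λ i → *-congˡ (trans (fromRays-ray (λ R → e R (σ i)) R ne col) (sym (e·e⁅⁆ R (σ i))))))
               (∑⊆-cong {m} (λ S → *-congˡ (trans (β-fromRays S r) (fromRays-ray (βRays S) R ne col)))) ⟩
        X + ∑⊆ (λ S → d S * βRays S R)
          ≈⟨ +-congˡ (trans (∑⊆-cong {m} (λ S → solve 3 (λ x y z → x :* (y :- z) := x :* y :- x :* z) refl
               (d S) (e R · vertex (I S) σ) (ind (S ⊆? R))))
               (∑⊆-sub (λ S → d S * (e R · vertex (I S) σ)) (λ S → d S * ind (S ⊆? R)))) ⟩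
        X + (Y - zeta d R) ∎

    zeta-small : ∀ R → ∣ R ∣ ℕ.≤ 1 → zeta d R ≈ 0#
    zeta-small R ∣R∣≤1 = ∑⊆-0 {m} term
      where
      term : ∀ S → d S * ind (S ⊆? R) ≈ 0#
      term S with S ⊆? R
      ... | no _ = zeroʳ _
      ... | yes S⊆R = trans (*-congʳ (d-supported S (λ (_ , 2≤∣S∣) →
              ℕ.<-irrefl ≡.refl (ℕ.≤-trans 2≤∣S∣ (ℕ.≤-trans (p⊆q⇒∣p∣≤∣q∣ S⊆R) ∣R∣≤1))))) (zeroˡ _)

    weight≈0 : ∀ s → weight s ≈ 0#
    weight≈0 s = begin-equality
      weight s          ≈⟨ e⁅⁆· s weight ⟨
      e ⁅ s ⁆ · weight  ≈⟨ relation ⁅ s ⁆ (s , x∈⁅x⁆ s) (⁅⁆-colored s) ⟩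
      zeta d ⁅ s ⁆      ≈⟨ zeta-small ⁅ s ⁆ (ℕ.≤-reflexive (∣⁅x⁆∣≡1 s)) ⟩
      0#                ∎

    ·weight≈0 : ∀ u → u · weight ≈ 0#
    ·weight≈0 u = sum-0 {m} (λ s → trans (*-congˡ (weight≈0 s)) (zeroʳ _))

    zeta≈0 : ∀ R → IsColored R → zeta d R ≈ 0#
    zeta≈0 R col with ∣ R ∣ ℕ.≤? 1
    ... | yes ∣R∣≤1 = zeta-small R ∣R∣≤1
    ... | no  ∣R∣≰1 = trans
      (sym (relation R (1≤∣p∣⇒nonempty (ℕ.<⇒≤ (ℕ.≰⇒> ∣R∣≰1))) col)) (·weight≈0 (e R))

    d≈0 : ∀ S → d S ≈ 0#
    d≈0 S with colored? S
    ... | yes col = zeta-injective {P = IsColored} (λ {S} {R} → ⊆-colored {S} {R}) d zeta≈0 S col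
    ... | no ¬col = d-supported S (¬col ∘ proj₁)

    b≈0 : ∀ i → b i ≈ 0#
    b≈0 i = begin-equality
      b i
        ≈⟨ trans (*-congˡ (trans (e·e⁅⁆ (E i) (σ i)) (e-in (∈E⁺ (πσ i))))) (*-identityʳ _) ⟨
      b i * (e (E i) · e ⁅ σ i ⁆)
        ≈⟨ sum-single {n} (λ j → b j * (e (E i) · e ⁅ σ j ⁆)) i (λ j j≢i → trans (*-congˡ (trans
             (e·e⁅⁆ (E i) (σ j)) (e-out (λ σ∈ → j≢i (≡.trans (≡.sym (πσ j)) (∈E⁻ σ∈)))))) (zeroʳ _)) ⟨
      X
        ≈⟨ solve 1 (λ x → x := x :+ con (+ 0) :- con (+ 0)) refl X ⟩
      X + 0# - 0#
        ≈⟨ +-cong (+-congˡ (∑⊆-0 {m} (λ S → trans (*-congʳ (d≈0 S)) (zeroˡ _))))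
                  (-‿cong (trans (·-comm (e (E i)) b′) (b′⊥L i))) ⟨
      X + ∑⊆ (λ S → d S * (e (E i) · vertex (I S) σ)) - e (E i) · b′
        ≈⟨ ·-weight (e (E i)) ⟨
      e (E i) · weight
        ≈⟨ ·weight≈0 (e (E i)) ⟩
      0# ∎
      where X = sum (λ j → b j * (e (E i) · e ⁅ σ j ⁆))

  -- Support functions, nefness and the basis

  module LargeClasses (2≤∣E∣ : ∀ i → 2 ℕ.≤ ∣ E i ∣) where

    colored-proper : ∀ {R} → IsColored R → Proper R
    colored-proper {R} col i with Fin.any? (λ t → (π t Fin.≟ i) ×-dec ¬? (t ∈? R))
    ... | yes found = found
    ... | no none = contradiction
      (ℕ.≤-trans (2≤∣E∣ i) (ℕ.≤-trans (p⊆q⇒∣p∣≤∣q∣ E⊆R∩E) (col i))) (ℕ.<-irrefl ≡.refl)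
      where
      E⊆R∩E : E i ⊆ R ∩ E i
      E⊆R∩E {t} t∈E with t ∈? R
      ... | yes t∈R = x∈p∩q⁺ (t∈R , t∈E)
      ... | no  t∉R = contradiction (t , ∈E⁻ t∈E , t∉R) none

    colored-chain : ColoredChain → Chain Proper
    colored-chain = mapChain (λ (_ , col) → colored-proper col)

    -- The one-member chain of ⁅ t ⁆; a point avoiding it has t-coordinate 0.
    singleton-chain : Fin m → Chain Proper
    singleton-chain t = colored-chain
      (chain (ray ⁅ t ⁆ (t , x∈⁅x⁆ t) (⁅⁆-colored t)))

    -- If the normal cone of a face contained e_t for every t of colour i, all
    -- coordinates of that colour would vanish on the face.
    normal-cone-proper : ∀ {R} → IsNormalConeRays R → Proper R
    normal-cone-proper {R} (v , (x , x-face) , R⇔) i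
      with Fin.any? (λ t → (π t Fin.≟ i) ×-dec ¬? (t ∈? R))
    ... | yes found = found
    ... | no none = contradiction 1≈0 1≉0
      where
      open Adapted (Δ-adapted ⊤) using (attained)
      x∈ : InΔ ⊤ x
      x∈ = to (Δ-⇔ ⊤ x) (proj₁ x-face)
      vanishes : ∀ t → t ∈ R → x t ≤ 0#
      vanishes t t∈R = let y , y∈ , tight = attained (singleton-chain t) in
        ≤-resp (e⁅⁆· t x) (tight Fin.zero) (proj₂ (to (R⇔ t) t∈R x x-face) y y∈)
      term : ∀ t → e (E i) t * x t ≈ 0#
      term t with t ∈? E i | t ∈? R
      ... | no _    | _       = zeroˡ _
      ... | yes _   | yes t∈R = trans (*-identityˡ _) (≤-antisym (vanishes t t∈R) (proj₁ x∈ t))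
      ... | yes t∈E | no t∉R  = contradiction (t , ∈E⁻ t∈E , t∉R) none
      1≈0 : 1# ≈ 0#
      1≈0 = begin-equality
        1#           ≈⟨ ind-true (i ∈? ⊤) ∈⊤ ⟨
        ind (i ∈? ⊤) ≈⟨ proj₂ x∈ i ⟨
        e (E i) · x  ≈⟨ sum-0 {m} term ⟩
        0#           ∎

    adapted-coarsens-barycentric : ∀ {Q φ κ} → Adapted Q φ κ → NormalFanCoarsensBarycentric Q
    adapted-coarsens-barycentric adapted C =
      adapted-coarsens adapted (mapChain (λ (_ , rays) → normal-cone-proper rays) C)

    adapted-max : ∀ {Q φ κ} → Extensional Q → Adapted Q φ κ → (∀ i → κ i ≈ 0#) →
      MaxRestrictsTo (negate Q) (λ p → - fromRays φ p)
    adapted-max {Q} {φ} {κ} ext adapted κ≈0 p u u≡ = IsMin-negate {Q} ext (IsMin-resp {Q}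
      (trans (+-congˡ (sum-0 {n} (λ i → trans (*-congˡ (κ≈0 i)) (zeroʳ _)))) (+-identityʳ _))
      (adapted-min adapted (colored-chain (chain p)) (coef≥0 p) u≡))

    negate-translate-⇔ : ∀ {Q} v → Extensional Q → ∀ x → negate (translate Q v) x ⇔ reflect v Q x
    negate-translate-⇔ v ext x = mk⇔ (ext (λ s → +-comm _ _)) (ext (λ s → +-comm _ _))

    translate-ext : ∀ {Q} v → Extensional Q → Extensional (translate Q v)
    translate-ext v ext x≈y = ext (λ s → +-congʳ (x≈y s))

    -- Minima of e_R over the translated simplex and the translated truncation.
    simplexRays : Fin m → Subset m → Carrier
    simplexRays s R = 0# - e R · e ⁅ s ⁆

    truncationRays : Subset m → Subset m → Carrier
    truncationRays S R = ind (S ⊆? R) - e R · e S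

    simplex-translate : ∀ i s → Adapted (translate (Simplex (E i)) (e ⁅ s ⁆))
      (simplexRays s) (λ j → ind (j ∈? ⁅ i ⁆) - e (E j) · e ⁅ s ⁆)
    simplex-translate i s = adapted-translate (e ⁅ s ⁆) (simplex-ext i) (simplex-adapted i)

    -- The outward support function of the translated simplex restricts to ℓ s.
    simplex-max-class : ∀ {i s} → π s ≡ i →
      MaxRestrictsToClass (negate (translate (Simplex (E i)) (e ⁅ s ⁆))) (α i)
    simplex-max-class {i} {s} πs≡i = (λ p → - fromRays (simplexRays s) p) ,
      adapted-max (translate-ext {Simplex (E i)} (e ⁅ s ⁆) (simplex-ext i))
        (simplex-translate i s) level0 ,
      ∼-fromRays {φ = λ R → - simplexRays s R} {ψ = λ R → e R (σ i)} (λ t → e ⁅ s ⁆ t - e ⁅ σ i ⁆ t) ⊥L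
        (fromRays-neg (simplexRays s)) (λ _ → refl) difference
      where
      level0 : ∀ j → ind (j ∈? ⁅ i ⁆) - e (E j) · e ⁅ s ⁆ ≈ 0#
      level0 j = x≈y⇒x-y≈0 (trans
        (ind-cong (j ∈? ⁅ i ⁆) (s ∈? E j)
          (λ j∈ → ∈E⁺ (≡.trans πs≡i (≡.sym (x∈⁅y⁆⇒x≡y i j∈))))
          (λ s∈ → ≡.subst (_∈ ⁅ i ⁆) (≡.trans (≡.sym πs≡i) (∈E⁻ s∈)) (x∈⁅x⁆ i)))
        (sym (e·e⁅⁆ (E j) s)))
      ⊥L : ∀ j → e (E j) · (λ t → e ⁅ s ⁆ t - e ⁅ σ i ⁆ t) ≈ 0#
      ⊥L j = trans (·-sub (e (E j)) (e ⁅ s ⁆) (e ⁅ σ i ⁆)) (x≈y⇒x-y≈0 (begin-equality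
        e (E j) · e ⁅ s ⁆    ≈⟨ e·e⁅⁆ (E j) s ⟩
        e (E j) s            ≈⟨ ind-cong (s ∈? E j) (σ i ∈? E j)
          (λ s∈ → ∈E⁺ (≡.trans (πσ i) (≡.trans (≡.sym πs≡i) (∈E⁻ s∈))))
          (λ σ∈ → ∈E⁺ (≡.trans πs≡i (≡.trans (≡.sym (πσ i)) (∈E⁻ σ∈)))) ⟩
        e (E j) (σ i)        ≈⟨ e·e⁅⁆ (E j) (σ i) ⟨
        e (E j) · e ⁅ σ i ⁆  ∎))
      difference : ∀ R → - (0# - e R · e ⁅ s ⁆) - e R (σ i) ≈ e R · (λ t → e ⁅ s ⁆ t - e ⁅ σ i ⁆ t)
      difference R = begin-equality
        - (0# - e R · e ⁅ s ⁆) - e R (σ i)   ≈⟨ +-cong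
            (solve 1 (λ x → :- (con (+ 0) :- x) := x) refl (e R · e ⁅ s ⁆))
            (-‿cong (sym (e·e⁅⁆ R (σ i)))) ⟩
        e R · e ⁅ s ⁆ - e R · e ⁅ σ i ⁆      ≈⟨ ·-sub (e R) (e ⁅ s ⁆) (e ⁅ σ i ⁆) ⟨
        e R · (λ t → e ⁅ s ⁆ t - e ⁅ σ i ⁆ t) ∎

    module _ {S : Subset m} (ne : Nonempty S) (col : IsColored S) where

      truncation-translate : Adapted (translate (T S) (e S))
        (truncationRays S) (λ i → ind (i ∈? I S) - e (E i) · e S)
      truncation-translate = adapted-translate (e S) (DTr-ext {S} ⊆-refl) (DTr-adapted ne ⊆-refl)

      truncation-level : ∀ i → ind (i ∈? I S) - e (E i) · e S ≈ 0#
      truncation-level i = x≈y⇒x-y≈0 (sym (E·e-colored col i))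

      -- The outward support function of the translated truncation restricts to
      -- the sum of the ℓ s with s ∈ S minus f S; it differs from β S by the linear
      -- function exchanging each s ∈ S for the representative of its colour.
      β-functional : V
      β-functional s = e S s - vertex (I S) σ s

      β-functional-⊥L : ∀ i → e (E i) · β-functional ≈ 0#
      β-functional-⊥L i = trans (·-sub (e (E i)) (e S) (vertex (I S) σ))
        (x≈y⇒x-y≈0 (trans (E·e-colored col i) (sym (proj₂ (vertex∈Δ πσ) i))))

      truncation-max-class : MaxRestrictsToClass (negate (translate (T S) (e S))) (β S)
      truncation-max-class = (λ p → - fromRays (truncationRays S) p) ,
        adapted-max (translate-ext {T S} (e S) (DTr-ext {S} ⊆-refl)) truncation-translate truncation-level ,
        ∼-fromRays {φ = λ R → - truncationRays S R} {ψ = βRays S} β-functional β-functional-⊥L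
          (fromRays-neg (truncationRays S)) (β-fromRays S) (λ R → trans
          (solve 3 (λ x y z → :- (x :- y) :- (z :- x) := y :- z) refl
            (ind (S ⊆? R)) (e R · e S) (e R · vertex (I S) σ))
          (sym (·-sub (e R) (e S) (vertex (I S) σ))))

      truncation-min : ∀ R (ne : Nonempty R) (col : IsColored R) → let r = ray R ne col in
        IsMin (translate (T S) (e S)) (e R) (f S r - ∑∈ S (λ s → ℓ s r))
      truncation-min R neR colR = IsMin-resp {translate (T S) (e S)} value
        (adapted-min truncation-translate (colored-chain (chain r)) (λ _ → 0≤1)
          ((λ _ → 0#) , λ s → trans (x≈y⇒x-y≈0 (sym (fromRays-ray (λ R → e R s) R neR colR)))
                                    (sym (sum-0 {n} (λ i → zeroˡ _)))))
        where
        r = ray R neR colR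
        ∑ℓ : e R · e S ≈ ∑∈ S (λ s → ℓ s r)
        ∑ℓ = begin-equality
          e R · e S                ≈⟨ ·-comm (e R) (e S) ⟩
          e S · e R                ≈⟨ ·-congˡ (e S) (λ s → fromRays-ray (λ R → e R s) R neR colR) ⟨
          e S · (λ s → ℓ s r)      ≈⟨ ∑∈≈e· S (λ s → ℓ s r) ⟨
          ∑∈ S (λ s → ℓ s r)       ∎
        value : fromRays (truncationRays S) r + sum (λ i → 0# * (ind (i ∈? I S) - e (E i) · e S))
                ≈ f S r - ∑∈ S (λ s → ℓ s r)
        value = begin-equality
          _ ≈⟨ +-cong (fromRays-ray (truncationRays S) R neR colR) (sum-0 {n} (λ i → zeroˡ _)) ⟩
          ind (S ⊆? R) - e R · e S + 0#   ≈⟨ +-identityʳ _ ⟩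
          ind (S ⊆? R) - e R · e S
            ≈⟨ +-cong (sym (fromRays-ray (λ R → ind (S ⊆? R)) R neR colR)) (-‿cong ∑ℓ) ⟩
          f S r - ∑∈ S (λ s → ℓ s r)      ∎

    -- The component of u in L(E) contributes equally to both minima.
    truncated-product-difference : ∀ {S} → Nonempty S → ∀ p u → u ≡L point p →
      ∃₂ λ μ ν → IsMin (T̂ S) u μ × IsMin ΔE u ν × μ - ν ≈ f S p
    truncated-product-difference {S} ne p u u≡ = _ , _ ,
      adapted-min (DTr-adapted {S} ne (λ _ → ∈⊤)) (colored-chain (chain p)) (coef≥0 p) u≡ ,
      adapted-min (Δ-adapted ⊤) (colored-chain (chain p)) (coef≥0 p) u≡ ,
      trans (+-congˡ (-‿cong (+-congʳ (sum-0 {Chain.length (chain p)} (λ j → zeroʳ _)))))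
        (solve 2 (λ x y → x :+ y :- (con (+ 0) :+ y) := x) refl (f S p) _)

    α-nef : ∀ i → IsNef (α i)
    α-nef i = translate (Simplex (E i)) (e ⁅ σ i ⁆) ,
      translate-polytope {Simplex (E i)} {⁅ i ⁆} ⁅ σ i ⁆ (λ x → to (simplex-Δ i x)) (simplex-polyhedron i) ,
      adapted-coarsens-barycentric (simplex-translate i (σ i)) , simplex-max-class (πσ i)

    β-nef : ∀ {S} → Nonempty S → IsColored S → IsNef (β S)
    β-nef {S} ne col = translate (T S) (e S) ,
      translate-polytope {T S} {I S} S (λ x → proj₁ ∘ to (DTr-⇔ {S} ⊆-refl x)) (DTr-polyhedron {S} ⊆-refl) ,
      adapted-coarsens-barycentric (truncation-translate ne col) , truncation-max-class ne col

    simplex-reflect-class : ∀ {i s} → π s ≡ i →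
      MaxRestrictsToClass (reflect (e ⁅ s ⁆) (Simplex (E i))) (α i)
    simplex-reflect-class {i} {s} πs≡i = class-⇔ {negate (translate (Simplex (E i)) (e ⁅ s ⁆))}
      (negate-translate-⇔ {Simplex (E i)} (e ⁅ s ⁆) (simplex-ext i)) (simplex-max-class πs≡i)

    truncation-reflect-class : ∀ {S} → Nonempty S → IsColored S →
      MaxRestrictsToClass (reflect (e S) (T S)) (β S)
    truncation-reflect-class {S} ne col = class-⇔ {negate (translate (T S) (e S))}
      (negate-translate-⇔ {T S} (e S) (DTr-ext {S} ⊆-refl)) (truncation-max-class ne col)

    α-pl : ∀ i → IsPiecewiseLinear (α i)
    α-pl i = class-well-defined {negate (translate (Simplex (E i)) (e ⁅ σ i ⁆))} (simplex-max-class (πσ i)) ,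
      fromRays-linear-on-cones {φ = λ R → e R (σ i)} (λ _ → refl)

    β-pl : ∀ {S} → Nonempty S → IsColored S → IsPiecewiseLinear (β S)
    β-pl {S} ne col = class-well-defined {negate (translate (T S) (e S))} (truncation-max-class ne col) ,
      fromRays-linear-on-cones {φ = βRays S} (β-fromRays S)

    basis : IsBasis α IsBig β
    basis = record
      { x-pl        = α-pl
      ; y-pl        = λ S big → β-pl (big-nonempty big) (proj₁ big)
      ; spanning    = λ g g-pl → let open Spanning g g-pl in b , d′ , d′-supported , g∼combination
      ; independent = λ b d supported (b′ , b′⊥L , ≈b′) →
          let open Independent b d supported b′ b′⊥L ≈b′ in b≈0 , d≈0
      }

proposition8p9 :
    ∀ {c ℓ₁ ℓ₂} (K : OrderedField c ℓ₁ ℓ₂) {m n} (π : Fin m → Fin n)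
      (π-surjective : Surjective _≡_ _≡_ π) →
    let open OrderedField K
        open ColoredFan K π π-surjective
        IsBig = λ (S : Subset m) → IsColored S × 2 ℕ.≤ ∣ S ∣
    in
    (∀ i → 2 ℕ.≤ ∣ E i ∣) →
    (∀ S → Nonempty S → IsColored S → ∀ R (ne : Nonempty R) (col : IsColored R) →
       let r = ray R ne col in
       IsMin (translate (T S) (e S)) (e R) (f S r - ∑∈ S (λ s → ℓ s r))) ×
    (∀ i s → π s ≡ i → MaxRestrictsToClass (reflect (e ⁅ s ⁆) (Simplex (E i))) (α i)) ×
    (∀ S → IsBig S → MaxRestrictsToClass (reflect (e S) (T S)) (β S)) ×
    IsBasis α IsBig β ×
    (∀ i → IsNef (α i)) ×
    (∀ S → IsBig S → IsNef (β S)) ×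
    (∀ S → Nonempty S → IsColored S → ∀ p u → u ≡L point p →
       ∃₂ λ μ ν → IsMin (T̂ S) u μ × IsMin ΔE u ν × μ - ν ≈ f S p)
proposition8p9 K π π-surjective 2≤∣E∣ =
  (λ S ne col → truncation-min ne col) ,
  (λ i s → simplex-reflect-class) ,
  (λ S big → truncation-reflect-class (big-nonempty big) (proj₁ big)) ,
  basis ,
  α-nef ,
  (λ S big → β-nef (big-nonempty big) (proj₁ big)) ,
  (λ S ne col → truncated-product-difference ne)
  where
  open FanProperties K π π-surjective
  open LargeClasses 2≤∣E∣
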